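{- Let $q$ be an odd prime power, $\mathbb F_q$ the finite field of order $q$, $d$ a positive integer, and $A\subset \mathbb F_q^d$. Let $\mathcal{SQ}(A)$ and $\mathcal{ZR}(A)$ be the number of pairs $(x,y)\in A\times A$ such that $\eta(\|x-y\|)=1$ and the number of pairs with $\eta(\|x-y\|)=0$, respectively. Then: \begin{enumerate} \item If $d\equiv 3 \pmod 4$ and $q\equiv 3\pmod 4$, then $$\mathcal{SQ}(A)+\mathcal{ZR}(A) \le \frac{|A|^2}{2} +\frac{|A|^2}{2q} - \frac{|A|^2}{2 q^{\frac{d-1}{2}}} - \frac{|A|^2}{2 q^{\frac{d+1}{2}}}+ q^{\frac{d-1}{2}} |A|.$$ \item If $d\equiv 1 \pmod 4$, or $d\equiv 3 \pmod 4$ and $q\equiv 1\pmod 4$, then $$\mathcal{SQ}(A)+\mathcal{ZR}(A) \le \frac{|A|^2}{2} +\frac{|A|^2}{2q}+ \frac{q^{\frac{d+1}{2}} |A|}{2} -\frac{q^{\frac{d-1}{2}} |A|}{2}.$$ \item If $d\equiv 2 \pmod 4$ and $q\equiv 3\pmod 4$, then $$\mathcal{SQ}(A)+\mathcal{ZR}(A) \le \frac{|A|^2}{2} +\frac{|A|^2}{2q}-\frac{|A|^2}{q^{\frac{d}{2}}}+ \frac{q^{\frac{d}{2}} |A|}{2} +\frac{q^{\frac{d-2}{2}}|A|}{2}.$$ \item If $d\equiv 0 \pmod 4$, or $d\equiv 2 \pmod 4$ and $q\equiv 1\pmod 4$, then $$\mathcal{SQ}(A)+\mathcal{ZR}(A)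 \le \frac{|A|^2}{2} +\frac{|A|^2}{2q}+ \frac{q^{\frac{d}{2}} |A|}{2}-\frac{q^{\frac{d-2}{2}}|A|}{2}.$$ \end{enumerate}
   Context: For $x,y\in\mathbb F_q^d$, $\|x-y\|:=(x_1-y_1)^2+\cdots+(x_d-y_d)^2\in\mathbb F_q$. $\eta$ denotes the quadratic character of $\mathbb F_q$ (so $\eta(a)=1$ if $a$ is a nonzero square, $\eta(a)=-1$ if $a$ is a non-square) with the convention $\eta(0)=0$. -}

module Defs where

open import Level using (Level; _⊔_) renaming (suc to lsuc)
open import Algebra.Bundles using (CommutativeRing)
import Algebra.Properties.CommutativeMonoid.Sum as Sum
open import Data.Nat.Base as ℕ using (ℕ; NonZero)
import Data.Nat.Properties as ℕₚ
open import Data.Nat.Primality using (Prime)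
open import Data.Integer.Base as ℤ using (ℤ; +_; 0ℤ; 1ℤ; -1ℤ)
import Data.Integer.Properties as ℤₚ
open import Data.Rational.Base as ℚ using (ℚ)
open import Data.Fin.Base using (Fin)
import Data.Fin.Properties as Finₚ
open import Data.Vec.Functional using (Vector)
import Data.Vec.Functional.Relation.Binary.Equality.Setoid as VecEq
open import Data.List.Base using (List; length; filter; cartesianProduct)
import Data.List.Relation.Unary.Unique.Setoid as UniqueS
open import Data.Product.Base using (∃; ∃₂; _×_; _,_)
open import Function.Bundles using (Inverse)
open import Relation.Nullary using (¬_; Dec; yes; no)
open import Relation.Nullary.Decidable using (map′)
open import Relation.Binary.PropositionalEquality using (_≡_; setoid)

OddPrimePower : ℕ → Set
OddPrimePower q =
  q ℕ.% 2 ≡ 1 × ∃₂ λ p k → Prime p × 1 ℕ.≤ k × q ≡ p ℕ.^ k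

infixl 7 _÷_ _÷⟨_^_⟩

_÷_ : ℕ → (n : ℕ) → .{{NonZero n}} → ℚ
m ÷ n = (+ m) ℚ./ n

_÷⟨_^_⟩ : ℕ → (b : ℕ) .{{_ : NonZero b}} → ℕ → ℚ
m ÷⟨ b ^ k ⟩ = ((+ m) ℚ./ (b ℕ.^ k)) {{ℕₚ.m^n≢0 b k}}

record FiniteField (c ℓ : Level) (q : ℕ) : Set (lsuc (c ⊔ ℓ)) where
  field
    commutativeRing : CommutativeRing c ℓ

  open CommutativeRing commutativeRing public
    renaming (setoid to ≈-setoid; refl to ≈-refl; sym to ≈-sym; trans to ≈-trans)

  field
    0≉1         : ¬ (0# ≈ 1#)
    invertible  : ∀ x → ¬ (x ≈ 0#) → ∃ λ y → x * y ≈ 1#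
    enumeration : Inverse (setoid (Fin q)) ≈-setoid

module _ {c ℓ : Level} {q : ℕ} (F : FiniteField c ℓ q) where
  open FiniteField F
  open Inverse enumeration
    using (to; from; to-cong; from-cong; strictlyInverseˡ)
  open Sum +-commutativeMonoid using (sum)

  _≟_ : ∀ x y → Dec (x ≈ y)
  x ≟ y = map′
    (λ eq → ≈-trans (≈-sym (strictlyInverseˡ x))
                    (≈-trans (to-cong eq) (strictlyInverseˡ y)))
    from-cong
    (from x Finₚ.≟ from y)

  IsSquare : Carrier → Set (c ⊔ ℓ)
  IsSquare a = ∃ λ b → b * b ≈ a

  isSquare? : ∀ a → Dec (IsSquare a)
  isSquare? a = map′
    (λ (i , eq) → to i , eq)
    (λ (b , eq) → from b ,
      ≈-trans (*-cong (strictlyInverseˡ b) (strictlyInverseˡ b)) eq)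
    (Finₚ.any? λ i → (to i * to i) ≟ a)

  η : Carrier → ℤ
  η a with a ≟ 0# | isSquare? a
  ... | yes _ | _     = 0ℤ
  ... | no  _ | yes _ = 1ℤ
  ... | no  _ | no  _ = -1ℤ

  Point : ℕ → Set c
  Point d = Vector Carrier d

  -- ‖ x - y ‖, an element of the field.
  dist : ∀ {d} → Point d → Point d → Carrier
  dist x y = sum λ i → (x i - y i) * (x i - y i)

  -- A subset of F^d is a duplicate-free list of points, so that its
  -- cardinality is the length of the list; distinctness is with respect to
  -- the pointwise lifting of the field's equality.
  Distinct : ∀ {d} → List (Point d) → Set (c ⊔ ℓ)
  Distinct {d} = UniqueS.Unique (VecEq.≋-setoid ≈-setoid d)

  -- The number of ordered pairs (x , y) ∈ A × A, including x = y, with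
  -- η ‖ x - y ‖ = e.
  pairs : ∀ {d} → ℤ → List (Point d) → ℕ
  pairs e A =
    length (filter (λ (x , y) → η (dist x y) ℤₚ.≟ e) (cartesianProduct A A))

  SQ ZR : ∀ {d} → List (Point d) → ℕ
  SQ = pairs 1ℤ
  ZR = pairs 0ℤ

{-# OPTIONS --safe #-}
-- Let N_ξ(c) count the x ∈ A with ξ·x = c. Cauchy–Schwarz gives q Σ_c N_ξ(c)² ≥ |A|² for every
-- ξ ∈ F_q^d, and the left side is q |A|² for ξ = 0. Summing over ξ with a nonnegative weight
-- w(‖ξ‖), where w is invariant under multiplication by nonzero squares, turns this into
-- an inequality for Σ_{x,y ∈ A} Σ_{ξ ⊥ x−y} w(‖ξ‖). For x ≠ y the inner sum depends on ‖x − y‖ only: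
-- Σ_s w(‖ξ‖ + 2s ξ·z) equals q w(‖ξ‖) or Σ w according to whether ξ ⊥ z, and translating ξ by
-- s z replaces ‖ξ‖ + 2s ξ·z by ‖ξ‖ − s²‖z‖. The resulting sums over F_q^d follow from
-- #{(s,r) : s² + r² = u} = q − ε + ε q [u = 0] with ε = η(−1), two coordinates at a time.
-- The weight is λ − K̂ up to scaling, for K = η(‖·‖) + [‖·‖ = 0] and λ the largest value of its
-- Fourier transform K̂ away from 0. Everything depends on the sign ε^⌊d/2⌋, and ε ≡ q (mod 4).
module Submission where

open import Defs
open import Level using (Level; _⊔_)
open import Data.Nat using (ℕ)

-- Additive characters would require roots of unity, so no Fourier transform is ever formed: only
-- its consequences for functions of ‖ξ‖ are proved, as identities between integers, and a factor q
-- is carried along wherever an exponent d - 1 would occur. The weight subtracts K̂ for a reason: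
-- transforming K̂ back returns K, so the sum attached to a pair x ≠ y is an affine function of
-- K(‖x-y‖), and K sums to 2(SQ + ZR) - |A|² over all pairs. The minus sign makes the resulting
-- bound an upper one. The constant λ has to be as small as nonnegativity permits, because the pairs
-- x = y contribute |A| times the total of the weight; this is the origin of the terms linear in
-- |A|. The value of the weight at 0 accounts for the difference between the cases. For sign +1 the
-- maximum λ is attained at norm 0, so this value vanishes. For sign -1 it is positive, and the
-- exact count at ξ = 0 turns it into the negative |A|² terms.

module Sums where

  open import Level using (Level)
  open import Data.Nat.Base as ℕ using (ℕ; zero; suc)
  import Data.Nat.Properties as ℕₚ
  import Data.Nat.DivMod as ℕ/
  import Data.Nat.Divisibility as ℕ∣
  import Data.Nat.Tactic.RingSolver as ℕ-Solver
  open import Data.Integer.Base as ℤ using (ℤ; -_; _+_; _*_; _-_; 0ℤ; 1ℤ; -1ℤ; _≤_; +≤+)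
  import Data.Integer.Properties as ℤₚ
  open import Data.Integer.Tactic.RingSolver using (solve-∀)
  open import Data.Fin.Base as Fin using (Fin; zero; suc)
  import Data.Fin.Properties as Finₚ
  open import Data.Fin.Permutation using (permutation)
  open import Data.List.Base using (List; []; _∷_; _++_; length; filter; map; lookup; cartesianProduct)
  open import Data.List.Properties using (filter-++; length-++)
  import Data.List.Relation.Unary.All as All
  open import Data.List.Relation.Unary.AllPairs using ([]; _∷_)
  open import Data.List.Relation.Unary.Unique.Setoid using (Unique)
  open import Data.List.Membership.Propositional.Properties using (∈-lookup)
  open import Data.Vec.Functional using (Vector)
  open import Data.Product.Base using (∃; _×_; _,_)
  open import Data.Sum.Base using (_⊎_; inj₁; inj₂)
  open import Function.Base using (_∘_)
  open import Relation.Nullary using (¬_; Dec; yes; no; contradiction)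
  open import Relation.Unary using (Pred; Decidable)
  open import Relation.Binary.Bundles using (Setoid)
  open import Relation.Binary.Definitions using (tri<; tri≈; tri>)
  open import Relation.Binary.PropositionalEquality
    using (_≡_; _≢_; refl; sym; trans; cong; cong₂; subst; module ≡-Reasoning)
  open import Algebra.Properties.Semiring.Sum ℤₚ.+-*-semiring
    using (sum; sum-cong-≗; ∑-distrib-+; *-distribˡ-sum; sum-permute)

  private variable
    n : ℕ
    a b p : Level
    A : Set a
    B : Set b
    P Q : Set a

  -- Finite sums of integers, indicators, parity.

  sum-const : ∀ n (k : ℤ) → sum {n} (λ _ → k) ≡ ℤ.+ n * k
  sum-const zero    k = sym (ℤₚ.*-zeroˡ k)
  sum-const (suc n) k = trans (cong (k +_) (sum-const n k)) (sym (ℤₚ.suc-* (ℤ.+ n) k))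

  sum-mono : {f g : Vector ℤ n} → (∀ i → f i ≤ g i) → sum f ≤ sum g
  sum-mono {zero}  le = ℤₚ.≤-refl
  sum-mono {suc n} le = ℤₚ.+-mono-≤ (le zero) (sum-mono (le ∘ suc))

  sum-*ˡ : ∀ (k : ℤ) (f : Vector ℤ n) → sum (λ i → k * f i) ≡ k * sum f
  sum-*ˡ k f = sym (*-distribˡ-sum k f)

  ∑∑ : (Fin n → Fin n → ℤ) → ℤ
  ∑∑ f = sum λ i → sum λ j → f i j

  ∑∑-cong : {f g : Fin n → Fin n → ℤ} → (∀ i j → f i j ≡ g i j) → ∑∑ f ≡ ∑∑ g
  ∑∑-cong eq = sum-cong-≗ λ i → sum-cong-≗ (eq i)

  ∑∑-+ : (f g : Fin n → Fin n → ℤ) → ∑∑ (λ i j → f i j + g i j) ≡ ∑∑ f + ∑∑ g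
  ∑∑-+ f g = trans (sum-cong-≗ λ i → ∑-distrib-+ (f i) (g i)) (∑-distrib-+ (sum ∘ f) (sum ∘ g))

  ∑∑-* : ∀ k (f : Fin n → Fin n → ℤ) → ∑∑ (λ i j → k * f i j) ≡ k * ∑∑ f
  ∑∑-* k f = trans (sum-cong-≗ λ i → sum-*ˡ k (f i)) (sum-*ˡ k (sum ∘ f))

  ∑∑-const : ∀ n k → ∑∑ {n} (λ _ _ → k) ≡ ℤ.+ n * (ℤ.+ n * k)
  ∑∑-const n k = trans (sum-const n (sum {n} λ _ → k)) (cong (ℤ.+ n *_) (sum-const n k))

  sum-*-sum : (f g : Fin n → ℤ) → sum f * sum g ≡ ∑∑ (λ i j → f i * g j)
  sum-*-sum f g = trans (ℤₚ.*-comm (sum f) (sum g)) (trans (sym (sum-*ˡ (sum g) f))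
    (sum-cong-≗ λ i → trans (ℤₚ.*-comm (sum g) (f i)) (sym (sum-*ˡ (f i) g))))

  -- Needed to pass from a vanishing total to pointwise identities for `η`: a tail that is at most 0
  -- forces the head up to 0.
  sum-zero⁻ : {f : Vector ℤ n} → (∀ i → f i ≤ 0ℤ) → sum f ≡ 0ℤ → ∀ i → f i ≡ 0ℤ
  sum-zero⁻ {n = suc n} {f} le eq = λ
    { zero    → head≡0
    ; (suc i) → sum-zero⁻ (le ∘ suc) tail≡0 i }
    where
    tail≤0 : sum (f ∘ suc) ≤ 0ℤ
    tail≤0 = ℤₚ.≤-trans (sum-mono (le ∘ suc))
               (ℤₚ.≤-reflexive (trans (sum-const n 0ℤ) (ℤₚ.*-zeroʳ (ℤ.+ n))))
    head≡0 : f zero ≡ 0ℤ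
    head≡0 = ℤₚ.≤-antisym (le zero)
      (ℤₚ.≤-trans (ℤₚ.≤-reflexive (sym eq))
        (ℤₚ.≤-trans (ℤₚ.+-monoʳ-≤ (f zero) tail≤0) (ℤₚ.≤-reflexive (ℤₚ.+-identityʳ (f zero)))))
    tail≡0 : sum (f ∘ suc) ≡ 0ℤ
    tail≡0 = trans (sym (ℤₚ.+-identityˡ _)) (trans (cong (_+ sum (f ∘ suc)) (sym head≡0)) eq)

  𝟙 : Dec P → ℤ
  𝟙 (yes _) = 1ℤ
  𝟙 (no  _) = 0ℤ

  𝟙-yes : (P? : Dec P) → P → 𝟙 P? ≡ 1ℤ
  𝟙-yes (yes _) p = refl
  𝟙-yes (no ¬p) p = contradiction p ¬p

  𝟙-no : (P? : Dec P) → ¬ P → 𝟙 P? ≡ 0ℤ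
  𝟙-no (yes p) ¬p = contradiction p ¬p
  𝟙-no (no _)  ¬p = refl

  𝟙-cong : {P : Set a} {Q : Set b} (P? : Dec P) (Q? : Dec Q) → (P → Q) → (Q → P) → 𝟙 P? ≡ 𝟙 Q?
  𝟙-cong (yes p) Q? to from = sym (𝟙-yes Q? (to p))
  𝟙-cong (no ¬p) Q? to from = sym (𝟙-no Q? (¬p ∘ from))

  sum-𝟙 : (j : Fin n) → sum (λ i → 𝟙 (i Finₚ.≟ j)) ≡ 1ℤ
  sum-𝟙 {suc n} zero = cong (1ℤ +_) (trans (sum-const n 0ℤ) (ℤₚ.*-zeroʳ (ℤ.+ n)))
  sum-𝟙 {suc n} (suc j) = trans (ℤₚ.+-identityˡ _)
    (trans (sum-cong-≗ λ i → 𝟙-cong (suc i Finₚ.≟ suc j) (i Finₚ.≟ j) Finₚ.suc-injective (cong suc)) (sum-𝟙 j))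

  -- Each two-element orbit of σ has exactly one point with i < σ i.
  fixpoint-free-involution⇒even : (σ : Fin n → Fin n) → (∀ i → σ (σ i) ≡ i) → (∀ i → σ i ≢ i) →
    ∃ λ (k : ℤ) → ℤ.+ n ≡ k + k
  fixpoint-free-involution⇒even {n} σ inv free = k , (begin
    ℤ.+ n                                      ≡⟨ ℤₚ.*-identityʳ (ℤ.+ n) ⟨
    ℤ.+ n * 1ℤ                                 ≡⟨ sum-const n 1ℤ ⟨
    sum {n} (λ _ → 1ℤ)                       ≡⟨ sum-cong-≗ one ⟩
    sum (λ i → up i + up (σ i))              ≡⟨ ∑-distrib-+ up (up ∘ σ) ⟩
    k + sum (up ∘ σ)                         ≡⟨ cong (k +_) (sum-permute up (permutation σ σ inv inv)) ⟨
    k + k                                    ∎)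
    where
    open ≡-Reasoning
    up : Fin n → ℤ
    up i = 𝟙 (i Finₚ.<? σ i)
    k = sum up
    one : ∀ i → 1ℤ ≡ up i + up (σ i)
    one i with Finₚ.<-cmp i (σ i)
    ... | tri< lt _ _ = sym (cong₂ _+_ (𝟙-yes (i Finₚ.<? σ i) lt)
            (𝟙-no (σ i Finₚ.<? σ (σ i)) λ p → Finₚ.<-asym lt (subst (σ i Fin.<_) (inv i) p)))
    ... | tri≈ _ eq _ = contradiction (sym eq) (free i)
    ... | tri> _ _ gt = sym (cong₂ _+_ (𝟙-no (i Finₚ.<? σ i) (Finₚ.<-asym gt))
            (𝟙-yes (σ i Finₚ.<? σ (σ i)) (subst (σ i Fin.<_) (sym (inv i)) gt)))

  -- The shift by 4 preserves the residue and turns `- e` into the natural number 3 or 5, so the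
  -- divisibility can be read in `ℕ`. The wrong sign would leave the residue 2.
  sign-from-residue : ∀ q {e m : ℤ} → (e ≡ 1ℤ) ⊎ (e ≡ -1ℤ) → ℤ.+ q - e + ℤ.+ 4 ≡ ℤ.+ 4 * m →
    (q ℕ.% 4 ≡ 3 → e ≡ -1ℤ) × (q ℕ.% 4 ≡ 1 → e ≡ 1ℤ)
  sign-from-residue q {m = m} = λ
    { (inj₁ refl) eq → (λ q%4≡3 → contradiction (trans (sym (residue 3 1ℤ refl eq)) (cong (λ r → (r ℕ.+ 3) ℕ.% 4) q%4≡3)) λ ())
                     , (λ _ → refl)
    ; (inj₂ refl) eq → (λ _ → refl)
                     , (λ q%4≡1 → contradiction (trans (sym (residue 5 -1ℤ refl eq)) (cong (λ r → (r ℕ.+ 1) ℕ.% 4) q%4≡1)) λ ()) }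
    where
    residue : ∀ r e → ℤ.+ r ≡ - e + ℤ.+ 4 → ℤ.+ q - e + ℤ.+ 4 ≡ ℤ.+ 4 * m →
      (q ℕ.% 4 ℕ.+ r ℕ.% 4) ℕ.% 4 ≡ 0
    residue r e r≡ eq = trans (sym (ℕ/.%-distribˡ-+ q r 4)) (ℕ∣.n∣m⇒m%n≡0 (q ℕ.+ r) 4
      (ℕ∣.divides ℤ.∣ m ∣ (trans
        (cong ℤ.∣_∣ (trans (cong (λ z → ℤ.+ q + z) r≡) (trans (sym (ℤₚ.+-assoc (ℤ.+ q) (- e) (ℤ.+ 4))) eq)))
        (trans (ℤₚ.abs-* (ℤ.+ 4) m) (ℕₚ.*-comm 4 ℤ.∣ m ∣)))))

  -- Cardinalities of filtered lists as sums of indicators.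

  length-filter-map : {P : Pred B p} (P? : Decidable P) (f : A → B) (ys : List A) →
    ℤ.+ length (filter P? (map f ys)) ≡ sum (λ j → 𝟙 (P? (f (lookup ys j))))
  length-filter-map P? f []       = refl
  length-filter-map P? f (y ∷ ys) with P? (f y)
  ... | yes _ = cong (λ z → 1ℤ + z) (length-filter-map P? f ys)
  ... | no  _ = trans (length-filter-map P? f ys) (sym (ℤₚ.+-identityˡ _))

  length-filter-cartesianProduct : {P : Pred (A × B) p} (P? : Decidable P) (xs : List A) (ys : List B) →
    ℤ.+ length (filter P? (cartesianProduct xs ys)) ≡ sum (λ i → sum λ j → 𝟙 (P? (lookup xs i , lookup ys j)))
  length-filter-cartesianProduct P? []       ys = refl
  length-filter-cartesianProduct P? (x ∷ xs) ys = begin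
    ℤ.+ length (filter P? (map (x ,_) ys ++ cartesianProduct xs ys))
      ≡⟨ cong (ℤ.+_ ∘ length) (filter-++ P? (map (x ,_) ys) (cartesianProduct xs ys)) ⟩
    ℤ.+ length (filter P? (map (x ,_) ys) ++ filter P? (cartesianProduct xs ys))
      ≡⟨ cong ℤ.+_ (length-++ (filter P? (map (x ,_) ys))) ⟩
    ℤ.+ length (filter P? (map (x ,_) ys)) + ℤ.+ length (filter P? (cartesianProduct xs ys))
      ≡⟨ cong₂ _+_ (length-filter-map P? (x ,_) ys) (length-filter-cartesianProduct P? xs ys) ⟩
    sum (λ j → 𝟙 (P? (x , lookup ys j))) + sum (λ i → sum λ j → 𝟙 (P? (lookup xs i , lookup ys j))) ∎
    where open ≡-Reasoning

  -- Lets the diagonal of a double sum over indices stand for equality of points.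
  lookup-injective : ∀ {c ℓ} (S : Setoid c ℓ) {xs : List (Setoid.Carrier S)} →
    Unique S xs → ∀ i j → Setoid._≈_ S (lookup xs i) (lookup xs j) → i ≡ j
  lookup-injective S (_ ∷ _)    zero    zero    _  = refl
  lookup-injective S (x∉ ∷ _)   zero    (suc j) eq = contradiction eq (All.lookup x∉ (∈-lookup j))
  lookup-injective S (x∉ ∷ _)   (suc i) zero    eq = contradiction (Setoid.sym S eq) (All.lookup x∉ (∈-lookup i))
  lookup-injective S (_ ∷ xs!)  (suc i) (suc j) eq = cong suc (lookup-injective S xs! i j eq)

  -- The dimension modulo 4 and the exponents derived from it.

  halve : ∀ k {m} → m ≡ k ℕ.* 2 → m ℕ./ 2 ≡ k
  halve k refl = ℕ/.m*n/n≡m k 2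

  -- The summand 0 keeps even dimensions in the shape `k * 2 + b` shared with odd ones, where b
  -- coordinates remain after pairing.
  half : ∀ k {m} → m ≡ k ℕ.* 2 ℕ.+ 0 → m ℕ./ 2 ≡ k
  half k eq = halve k (trans eq (ℕₚ.+-identityʳ (k ℕ.* 2)))

  half-pred : ∀ k {m} → m ≡ k ℕ.* 2 ℕ.+ 1 → (m ℕ.∸ 1) ℕ./ 2 ≡ k
  half-pred k refl = halve k (ℕₚ.m+n∸n≡m (k ℕ.* 2) 1)

  half-suc : ∀ k {m} → m ≡ k ℕ.* 2 ℕ.+ 1 → (m ℕ.+ 1) ℕ./ 2 ≡ suc k
  half-suc k refl = halve (suc k) (trans (ℕₚ.+-assoc (k ℕ.* 2) 1 1) (ℕₚ.+-comm (k ℕ.* 2) 2))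

  quotient-form : ∀ {d r e} → d ℕ.% 4 ≡ r → r ℕ.+ d ℕ./ 4 ℕ.* 4 ≡ e → d ≡ e
  quotient-form {d} refl eq = trans (ℕ/.m≡m%n+[m/n]*n d 4) eq

  -- This form and the next ones exhibit ⌊d/2⌋ as an explicit even or odd number, because its parity
  -- decides the sign ε^⌊d/2⌋.
  1-mod-4 : ∀ {d} → d ℕ.% 4 ≡ 1 → d ≡ d ℕ./ 4 ℕ.* 2 ℕ.* 2 ℕ.+ 1
  1-mod-4 {d} d%4≡1 = quotient-form d%4≡1 (lem (d ℕ./ 4))
    where
    lem : ∀ j → 1 ℕ.+ j ℕ.* 4 ≡ j ℕ.* 2 ℕ.* 2 ℕ.+ 1
    lem = ℕ-Solver.solve-∀

  2-mod-4 : ∀ {d} → d ℕ.% 4 ≡ 2 → d ≡ suc (d ℕ./ 4 ℕ.* 2) ℕ.* 2 ℕ.+ 0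
  2-mod-4 {d} d%4≡2 = quotient-form d%4≡2 (lem (d ℕ./ 4))
    where
    lem : ∀ j → 2 ℕ.+ j ℕ.* 4 ≡ suc (j ℕ.* 2) ℕ.* 2 ℕ.+ 0
    lem = ℕ-Solver.solve-∀

  3-mod-4 : ∀ {d} → d ℕ.% 4 ≡ 3 → d ≡ suc (d ℕ./ 4 ℕ.* 2) ℕ.* 2 ℕ.+ 1
  3-mod-4 {d} d%4≡3 = quotient-form d%4≡3 (lem (d ℕ./ 4))
    where
    lem : ∀ j → 3 ℕ.+ j ℕ.* 4 ≡ suc (j ℕ.* 2) ℕ.* 2 ℕ.+ 1
    lem = ℕ-Solver.solve-∀

  -- Positivity of d makes the quotient a successor, so that d/2 has a predecessor to serve as the
  -- exponent (d - 2)/2.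
  0-mod-4 : ∀ {d} → d ℕ.≥ 1 → d ℕ.% 4 ≡ 0 → ∃ λ j → d ≡ suc (suc (j ℕ.* 2)) ℕ.* 2 ℕ.+ 0
  0-mod-4 {d} d≥1 d%4≡0 = positive-quotient (d ℕ./ 4) (quotient-form d%4≡0 refl)
    where
    lem : ∀ j → suc j ℕ.* 4 ≡ suc (suc (j ℕ.* 2)) ℕ.* 2 ℕ.+ 0
    lem = ℕ-Solver.solve-∀
    positive-quotient : ∀ j → d ≡ j ℕ.* 4 → ∃ λ j → d ≡ suc (suc (j ℕ.* 2)) ℕ.* 2 ℕ.+ 0
    positive-quotient zero    d≡0 = contradiction d≡0 (ℕₚ.m<n⇒n≢0 d≥1)
    positive-quotient (suc j) d≡  = j , trans d≡ (lem j)

  1-mod-2 : ∀ {q} → q ℕ.% 2 ≡ 1 → q ≡ suc (q ℕ./ 2 ℕ.+ q ℕ./ 2)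
  1-mod-2 {q} q%2≡1 = trans (ℕ/.m≡m%n+[m/n]*n q 2) (trans (cong (ℕ._+ q ℕ./ 2 ℕ.* 2) q%2≡1) (lem (q ℕ./ 2)))
    where
    lem : ∀ j → 1 ℕ.+ j ℕ.* 2 ≡ suc (j ℕ.+ j)
    lem = ℕ-Solver.solve-∀

-- Clearing denominators: from rational to integer inequalities.

module Rationals where

  open import Defs using (_÷_; _÷⟨_^_⟩)
  open import Data.Nat.Base as ℕ using (ℕ; zero; suc)
  import Data.Nat.Properties as ℕₚ
  open import Data.Integer.Base as ℤ using (ℤ; _+_; _*_; _-_; _≤_; 1ℤ)
  import Data.Integer.Properties as ℤₚ
  open import Data.Rational as ℚ using (ℚ; ½; fromℚᵘ; toℚᵘ) renaming (_+_ to _⊕_; _-_ to _⊖_; _*_ to _⊛_)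
  import Data.Rational.Properties as ℚₚ
  import Data.Rational.Unnormalised as ℚᵘ
  import Data.Rational.Unnormalised.Properties as ℚᵘₚ
  open import Data.Rational.Solver using (module +-*-Solver)
  open +-*-Solver using (solve; _:=_; _:+_; _:*_; _:-_)
  open import Relation.Binary.PropositionalEquality using (_≡_; refl; sym; trans; cong; cong₂; subst)

  -- `ℚ` reduces every fraction by a gcd, so its operations do not compute on variables; the
  -- unnormalised formulas do.
  fromℚᵘ-homo-+ : ∀ a b → fromℚᵘ a ⊕ fromℚᵘ b ≡ fromℚᵘ (a ℚᵘ.+ b)
  fromℚᵘ-homo-+ a b = trans (sym (ℚₚ.fromℚᵘ-toℚᵘ _)) (ℚₚ.fromℚᵘ-cong
    (ℚᵘₚ.≃-trans (ℚₚ.toℚᵘ-homo-+ (fromℚᵘ a) (fromℚᵘ b)) (ℚᵘₚ.+-cong (ℚₚ.toℚᵘ-fromℚᵘ a) (ℚₚ.toℚᵘ-fromℚᵘ b))))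

  fromℚᵘ-homo-* : ∀ a b → fromℚᵘ a ⊛ fromℚᵘ b ≡ fromℚᵘ (a ℚᵘ.* b)
  fromℚᵘ-homo-* a b = trans (sym (ℚₚ.fromℚᵘ-toℚᵘ _)) (ℚₚ.fromℚᵘ-cong
    (ℚᵘₚ.≃-trans (ℚₚ.toℚᵘ-homo-* (fromℚᵘ a) (fromℚᵘ b)) (ℚᵘₚ.*-cong (ℚₚ.toℚᵘ-fromℚᵘ a) (ℚₚ.toℚᵘ-fromℚᵘ b))))

  fromℚᵘ-homo-neg : ∀ a → ℚ.- fromℚᵘ a ≡ fromℚᵘ (ℚᵘ.- a)
  fromℚᵘ-homo-neg a = trans (sym (ℚₚ.fromℚᵘ-toℚᵘ _)) (ℚₚ.fromℚᵘ-cong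
    (ℚᵘₚ.≃-trans (ℚₚ.toℚᵘ-homo‿- (fromℚᵘ a)) (ℚᵘₚ.-‿cong (ℚₚ.toℚᵘ-fromℚᵘ a))))

  ι : ℤ → ℚ
  ι i = i ℚ./ 1

  private variable
    i j : ℤ
    x y : ℚ

  infix 4 _≐_
  infixl 6 _⟨+⟩_ _⟨-⟩_
  infixl 7 _⟨*⟩_

  -- A record rather than an abbreviation: ι computes, so i could not be inferred from x ≡ ι i.
  record _≐_ (x : ℚ) (i : ℤ) : Set where
    constructor integral
    field to-≡ : x ≡ ι i
  open _≐_

  exact : ∀ i → ι i ≐ i
  exact i = integral refl

  -- Combining such proofs along an expression makes unification find the integer that the
  -- expression equals.
  _⟨+⟩_ : x ≐ i → y ≐ j → x ⊕ y ≐ i + j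
  _⟨+⟩_ {i = i} {j = j} (integral refl) (integral refl) = integral (trans
    (fromℚᵘ-homo-+ (ℚᵘ.mkℚᵘ i 0) (ℚᵘ.mkℚᵘ j 0))
    (cong ι (cong₂ _+_ (ℤₚ.*-identityʳ i) (ℤₚ.*-identityʳ j))))

  _⟨*⟩_ : x ≐ i → y ≐ j → x ⊛ y ≐ i * j
  _⟨*⟩_ {i = i} {j = j} (integral refl) (integral refl) =
    integral (fromℚᵘ-homo-* (ℚᵘ.mkℚᵘ i 0) (ℚᵘ.mkℚᵘ j 0))

  _⟨-⟩_ : x ≐ i → y ≐ j → x ⊖ y ≐ i - j
  _⟨-⟩_ {j = j} x≐i (integral refl) = x≐i ⟨+⟩ integral (fromℚᵘ-homo-neg (ℚᵘ.mkℚᵘ j 0))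

  ι-mono : i ≤ j → ι i ℚ.≤ ι j
  ι-mono {i} {j} i≤j = ℚₚ.toℚᵘ-cancel-≤ (begin
    toℚᵘ (ι i)        ≃⟨ ℚₚ.toℚᵘ-fromℚᵘ (ℚᵘ.mkℚᵘ i 0) ⟩
    ℚᵘ.mkℚᵘ i 0       ≤⟨ ℚᵘ.*≤* (ℤₚ.*-monoʳ-≤-nonNeg 1ℤ i≤j) ⟩
    ℚᵘ.mkℚᵘ j 0       ≃⟨ ℚₚ.toℚᵘ-fromℚᵘ (ℚᵘ.mkℚᵘ j 0) ⟨
    toℚᵘ (ι j)        ∎)
    where open ℚᵘₚ.≤-Reasoning

  respˡ-≐ : x ≡ y → y ≐ i → x ≐ i
  respˡ-≐ refl y≐i = y≐i

  ÷-cancel : ∀ m b .{{_ : ℕ.NonZero b}} → (m ÷ b) ⊛ ι (ℤ.+ b) ≡ ι (ℤ.+ m)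
  ÷-cancel m (suc b) = trans (fromℚᵘ-homo-* (ℚᵘ.mkℚᵘ (ℤ.+ m) b) (ℚᵘ.mkℚᵘ (ℤ.+ suc b) 0))
    (ℚₚ.fromℚᵘ-cong {ℚᵘ.mkℚᵘ (ℤ.+ m) b ℚᵘ.* ℚᵘ.mkℚᵘ (ℤ.+ suc b) 0} {ℚᵘ.mkℚᵘ (ℤ.+ m) 0}
      (ℚᵘ.*≡* (trans (ℤₚ.*-identityʳ _) (cong (λ c → ℤ.+ m * c) (cong ℤ.+_ (sym (ℕₚ.*-identityʳ (suc b))))))))

  -- A positive common denominator can be cancelled, which leaves an inequality of integers. The
  -- multiplier is `k′` rather than `ι k` so that it may be a product of several images, one for
  -- each fraction to clear.
  ι-clear : ∀ {x M k k′ s} → ℤ.Positive k → k′ ≐ k → x ⊛ k′ ≐ s → M * k ≤ s → ι M ℚ.≤ x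
  ι-clear {x} {M} {k@(ℤ.+[1+ b ])} {s = s} k>0 (integral refl) (integral eq) le = ℚₚ.*-cancelʳ-≤-pos (ι k) {{pos}} (begin
    ι M ⊛ ι k    ≡⟨ to-≡ (exact M ⟨*⟩ exact k) ⟩
    ι (M * k)    ≤⟨ ι-mono le ⟩
    ι s          ≡⟨ eq ⟨
    x ⊛ ι k      ∎)
    where
    open ℚₚ.≤-Reasoning
    pos : ℚ.Positive (ι k)
    pos = ℚₚ.normalize-pos (suc b) 1

  *-positive : ∀ {i j} → ℤ.Positive i → ℤ.Positive j → ℤ.Positive (i * j)
  *-positive {ℤ.+[1+ m ]} {ℤ.+[1+ n ]} _ _ = _

  ^-positive : ∀ {i} k → ℤ.Positive i → ℤ.Positive (i ℤ.^ k)
  ^-positive zero    i>0 = _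
  ^-positive (suc k) i>0 = *-positive i>0 (^-positive k i>0)

  pos-^ : ∀ q k → ℤ.+ (q ℕ.^ k) ≡ (ℤ.+ q) ℤ.^ k
  pos-^ q zero    = refl
  pos-^ q (suc k) = trans (ℤₚ.pos-* q (q ℕ.^ k)) (cong (ℤ.+ q *_) (pos-^ q k))

  pos-² : ∀ n → ℤ.+ (n ℕ.^ 2) ≡ ℤ.+ n * ℤ.+ n
  pos-² n = trans (pos-^ n 2) (cong (ℤ.+ n *_) (ℤₚ.*-identityʳ (ℤ.+ n)))

  module _ (n q M : ℕ) .{{_ : ℕ.NonZero q}} where
    private
      N Q : ℤ
      N = ℤ.+ n
      Q = ℤ.+ q
      two : ℤ
      two = ℤ.+ 2
      square÷ : ∀ b .{{_ : ℕ.NonZero b}} → (n ℕ.^ 2 ÷ b) ⊛ ι (ℤ.+ b) ≐ N * N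
      square÷ b = integral (trans (÷-cancel (n ℕ.^ 2) b) (cong ι (pos-² n)))
      power÷ : ∀ k b .{{_ : ℕ.NonZero b}} → ((q ℕ.^ k ℕ.* n) ÷ b) ⊛ ι (ℤ.+ b) ≐ Q ℤ.^ k * N
      power÷ k b = integral (trans (÷-cancel (q ℕ.^ k ℕ.* n) b)
        (cong ι (trans (ℤₚ.pos-* (q ℕ.^ k) n) (cong (_* N) (pos-^ q k)))))
      ÷power : ∀ k → (n ℕ.^ 2 ÷⟨ q ^ k ⟩) ⊛ ι (Q ℤ.^ k) ≐ N * N
      ÷power k = subst (λ z → (n ℕ.^ 2 ÷⟨ q ^ k ⟩) ⊛ ι z ≐ N * N) (pos-^ q k) (square÷ (q ℕ.^ k) {{ℕₚ.m^n≢0 q k}})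
      half : ½ ⊛ ι two ≐ 1ℤ
      half = integral refl
      Q>0 : ℤ.Positive Q
      Q>0 = nonzero⇒positive q
        where
        nonzero⇒positive : ∀ q .{{_ : ℕ.NonZero q}} → ℤ.Positive (ℤ.+ q)
        nonzero⇒positive (suc q) = _

    -- Serves both cases with sign +1, whose exponents are consecutive in either parity of d. The
    -- integer hypothesis has the shape that the combinators produce; for instance `1ℤ * (N * N)` is
    -- ½ · 2 times (n²/q) · q.
    clear-difference : ∀ k {a b} → a ≡ suc k → b ≡ k →
      ℤ.+ M * (two * Q) ≤ N * N * Q + 1ℤ * (N * N) + Q ℤ.^ suc k * N * Q - Q ℤ.^ k * N * Q →
      M ÷ 1 ℚ.≤ n ℕ.^ 2 ÷ 2 ⊕ ½ ⊛ (n ℕ.^ 2 ÷ q) ⊕ (q ℕ.^ a ℕ.* n) ÷ 2 ⊖ (q ℕ.^ b ℕ.* n) ÷ 2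
    clear-difference k refl refl = ι-clear {M = ℤ.+ M} (*-positive {two} _ Q>0)
      (exact two ⟨*⟩ exact Q)
      (respˡ-≐ (solve 7 (λ a h b c d t q → (a :+ h :* b :+ c :- d) :* (t :* q) :=
                a :* t :* q :+ h :* t :* (b :* q) :+ c :* t :* q :- d :* t :* q) refl
                (n ℕ.^ 2 ÷ 2) ½ (n ℕ.^ 2 ÷ q) ((q ℕ.^ suc k ℕ.* n) ÷ 2) ((q ℕ.^ k ℕ.* n) ÷ 2) (ι two) (ι Q))
        (square÷ 2 ⟨*⟩ exact Q ⟨+⟩ half ⟨*⟩ square÷ q ⟨+⟩ power÷ (suc k) 2 ⟨*⟩ exact Q ⟨-⟩ power÷ k 2 ⟨*⟩ exact Q))

    -- The common denominator is not the least one, but it lets each fraction be cleared by a factor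
    -- of its own: n²/2 by 2, n²/q by Q and n²/q^a by the power of Q.
    clear-even : ∀ k {a b} → a ≡ suc k → b ≡ k →
      ℤ.+ M * (two * (Q ℤ.^ suc k * Q)) ≤
        N * N * (Q ℤ.^ suc k * Q) + 1ℤ * (N * N) * Q ℤ.^ suc k - N * N * (two * Q)
        + Q ℤ.^ suc k * N * (Q ℤ.^ suc k * Q) + Q ℤ.^ k * N * (Q ℤ.^ suc k * Q) →
      M ÷ 1 ℚ.≤ n ℕ.^ 2 ÷ 2 ⊕ ½ ⊛ (n ℕ.^ 2 ÷ q) ⊖ n ℕ.^ 2 ÷⟨ q ^ a ⟩ ⊕ (q ℕ.^ a ℕ.* n) ÷ 2 ⊕ (q ℕ.^ b ℕ.* n) ÷ 2
    clear-even k refl refl = ι-clear {M = ℤ.+ M} (*-positive {two} _ (*-positive (^-positive (suc k) Q>0) Q>0))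
      (exact two ⟨*⟩ (exact (Q ℤ.^ suc k) ⟨*⟩ exact Q))
      (respˡ-≐ (solve 9 (λ a h b c d e t p q → (a :+ h :* b :- e :+ c :+ d) :* (t :* (p :* q)) :=
                a :* t :* (p :* q) :+ h :* t :* (b :* q) :* p :- e :* p :* (t :* q) :+ c :* t :* (p :* q) :+ d :* t :* (p :* q)) refl
                (n ℕ.^ 2 ÷ 2) ½ (n ℕ.^ 2 ÷ q) ((q ℕ.^ suc k ℕ.* n) ÷ 2) ((q ℕ.^ k ℕ.* n) ÷ 2) (n ℕ.^ 2 ÷⟨ q ^ suc k ⟩)
                (ι two) (ι (Q ℤ.^ suc k)) (ι Q))
        (square÷ 2 ⟨*⟩ (exact P ⟨*⟩ exact Q) ⟨+⟩ half ⟨*⟩ square÷ q ⟨*⟩ exact P ⟨-⟩ ÷power (suc k) ⟨*⟩ (exact two ⟨*⟩ exact Q)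
          ⟨+⟩ power÷ (suc k) 2 ⟨*⟩ (exact P ⟨*⟩ exact Q) ⟨+⟩ power÷ k 2 ⟨*⟩ (exact P ⟨*⟩ exact Q)))
      where
      P = Q ℤ.^ suc k

    clear-odd : ∀ k {a b} → a ≡ k → b ≡ suc k →
      ℤ.+ M * (two * (Q * Q ℤ.^ k)) ≤
        N * N * (Q * Q ℤ.^ k) + 1ℤ * (N * N) * Q ℤ.^ k - 1ℤ * (N * N) * Q - 1ℤ * (N * N)
        + Q ℤ.^ k * N * (two * (Q * Q ℤ.^ k)) →
      M ÷ 1 ℚ.≤ n ℕ.^ 2 ÷ 2 ⊕ ½ ⊛ (n ℕ.^ 2 ÷ q) ⊖ ½ ⊛ (n ℕ.^ 2 ÷⟨ q ^ a ⟩) ⊖ ½ ⊛ (n ℕ.^ 2 ÷⟨ q ^ b ⟩) ⊕ (q ℕ.^ a ℕ.* n) ÷ 1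
    clear-odd k refl refl = ι-clear {M = ℤ.+ M} (*-positive {two} _ (^-positive (suc k) Q>0))
      (exact two ⟨*⟩ (exact Q ⟨*⟩ exact (Q ℤ.^ k)))
      (respˡ-≐ (solve 9 (λ a h b c d e t p q → (a :+ h :* b :- h :* c :- h :* d :+ e) :* (t :* (q :* p)) :=
                a :* t :* (q :* p) :+ h :* t :* (b :* q) :* p :- h :* t :* (c :* p) :* q :- h :* t :* (d :* (q :* p)) :+ e :* (t :* (q :* p))) refl
                (n ℕ.^ 2 ÷ 2) ½ (n ℕ.^ 2 ÷ q) (n ℕ.^ 2 ÷⟨ q ^ k ⟩) (n ℕ.^ 2 ÷⟨ q ^ suc k ⟩) ((q ℕ.^ k ℕ.* n) ÷ 1)
                (ι two) (ι (Q ℤ.^ k)) (ι Q))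
        (square÷ 2 ⟨*⟩ (exact Q ⟨*⟩ exact P) ⟨+⟩ half ⟨*⟩ square÷ q ⟨*⟩ exact P ⟨-⟩ half ⟨*⟩ ÷power k ⟨*⟩ exact Q
          -- The denominator is a single power of q, whereas the multiplier supplies `ι Q` and
          -- `ι (Q ℤ.^ k)` separately.
          ⟨-⟩ half ⟨*⟩ respˡ-≐ (cong (n ℕ.^ 2 ÷⟨ q ^ suc k ⟩ ⊛_) (to-≡ (exact Q ⟨*⟩ exact (Q ℤ.^ k)))) (÷power (suc k))
          ⟨+⟩ power÷1 ⟨*⟩ (exact two ⟨*⟩ (exact Q ⟨*⟩ exact P))))
      where
      P = Q ℤ.^ k
      power÷1 : (q ℕ.^ k ℕ.* n) ÷ 1 ≐ Q ℤ.^ k * N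
      power÷1 = integral (cong ι (trans (ℤₚ.pos-* (q ℕ.^ k) n) (cong (_* N) (pos-^ q k))))

module FieldSums {c ℓ : Level} {q : ℕ} (F : FiniteField c ℓ q) where

  open Sums
  open Rationals
  open import Data.Nat.Base as ℕ using (ℕ; zero; suc)
  import Data.Nat.Properties as ℕₚ
  open import Data.Integer.Base as ℤ using (ℤ; -_; _+_; _*_; _-_; 0ℤ; 1ℤ; -1ℤ; _≤_; +≤+; -≤+)
  import Data.Integer.Properties as ℤₚ
  open import Data.Integer.Tactic.RingSolver using (solve-∀)
  open import Data.Rational as ℚ using (½) renaming (_+_ to _⊕_; _-_ to _⊖_; _*_ to _⊛_)
  open import Data.Fin.Base as Fin using (Fin; zero; suc)
  import Data.Fin.Properties as Finₚ
  open import Data.Fin.Permutation using (permutation)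
  open import Data.List.Base using (List; length; lookup)
  open import Data.Vec.Functional using ([]; _∷_)
  import Data.Vec.Functional.Relation.Binary.Equality.Setoid as VecEq
  open import Data.Product.Base using (∃; _,_; proj₁; proj₂)
  open import Data.Sum.Base using (_⊎_; inj₁; inj₂)
  open import Data.Empty using (⊥-elim)
  open import Function.Base using (_∘_)
  open import Function.Bundles using (Inverse)
  open import Relation.Nullary using (¬_; Dec; yes; no; contradiction)
  open import Relation.Binary.PropositionalEquality
    using (_≡_; _≢_; refl; sym; trans; cong; cong₂; subst; subst₂; module ≡-Reasoning)
  open import Algebra.Bundles using (CommutativeRing)
  open import Algebra.Properties.Semiring.Sum ℤₚ.+-*-semiring
    using (sum; sum-cong-≗; ∑-distrib-+; ∑-comm; sum-permute)
  open import Algebra.Properties.Ring ℤₚ.+-*-ring using () renaming (+-cancelˡ to ℤ-+-cancelˡ)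
  open FiniteField F
    using ( Carrier; _≈_; 0#; 1#; ≈-refl; ≈-sym; ≈-trans; ≈-setoid; 0≉1; invertible; enumeration
          ; commutativeRing; +-cong; +-congˡ; +-congʳ; *-cong; *-congˡ; *-congʳ; -‿cong
          ; +-assoc; +-comm; +-identityˡ; +-identityʳ; -‿inverseˡ; -‿inverseʳ
          ; *-assoc; *-comm; *-identityˡ; *-identityʳ; zeroˡ; zeroʳ; distribˡ; distribʳ)
    renaming (_+_ to _+ᶠ_; _*_ to _*ᶠ_; -_ to -ᶠ_; _-_ to _-ᶠ_; reflexive to ≈-reflexive)
  open Inverse enumeration using (to; from; to-cong; from-cong; strictlyInverseˡ; strictlyInverseʳ)
  open import Algebra.Properties.Ring (CommutativeRing.ring commutativeRing)
    using (-‿distribˡ-*; -‿distribʳ-*; -‿+-comm; -0#≈0#; x[y-z]≈xy-xz)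
    renaming ( -‿involutive to -ᶠ-involutive; x∙y⁻¹≈ε⇒x≈y to x-y≈0⇒x≈y
             ; x≈y⇒x∙y⁻¹≈ε to x≈y⇒x-y≈0; ⁻¹-anti-homo-// to -[x-y]≈y-x)
  open import Algebra.Properties.CommutativeMonoid.Sum (CommutativeRing.+-commutativeMonoid commutativeRing)
    using () renaming (sum to sumᶠ)
  open import Algebra.Solver.Ring.NaturalCoefficients.Default
    (CommutativeRing.commutativeSemiring commutativeRing) using (solve; _:=_; _:+_; _:*_)

  module ≈-R where
    open import Relation.Binary.Reasoning.Setoid ≈-setoid public
  _≟ᶠ_ : ∀ x y → Dec (x ≈ y)
  _≟ᶠ_ = _≟_ F

  -- Summation over the field.

  Resp : ∀ {a} {A : Set a} → (Carrier → A) → Set _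
  Resp φ = ∀ {x y} → x ≈ y → φ x ≡ φ y

  ∫ : (Carrier → ℤ) → ℤ
  ∫ φ = sum {q} (φ ∘ to)

  ∫-cong : {φ ψ : Carrier → ℤ} → (∀ x → φ x ≡ ψ x) → ∫ φ ≡ ∫ ψ
  ∫-cong eq = sum-cong-≗ (eq ∘ to)

  ∫-+ : ∀ φ ψ → ∫ (λ x → φ x + ψ x) ≡ ∫ φ + ∫ ψ
  ∫-+ φ ψ = ∑-distrib-+ (φ ∘ to) (ψ ∘ to)

  ∫-* : ∀ k φ → ∫ (λ x → k * φ x) ≡ k * ∫ φ
  ∫-* k φ = sum-*ˡ k (φ ∘ to)

  ∫-const : ∀ k → ∫ (λ _ → k) ≡ ℤ.+ q * k
  ∫-const = sum-const q

  -- Conjugating by the enumeration turns a bijection up to `_≈_` into a permutation of `Fin q`; the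
  -- integrand must respect `_≈_` because the enumeration inverts only up to it.
  ∫-bij : (f g : Carrier → Carrier) → (∀ {x y} → x ≈ y → f x ≈ f y) → (∀ {x y} → x ≈ y → g x ≈ g y) →
    (∀ x → f (g x) ≈ x) → (∀ x → g (f x) ≈ x) → ∀ {φ} → Resp φ → ∫ (φ ∘ f) ≡ ∫ φ
  ∫-bij f g f-cong g-cong fg gf {φ} φ-cong = sym (trans
    (sum-permute (φ ∘ to) (permutation (lift f) (lift g) (lift-inv g-cong f-cong fg) (lift-inv f-cong g-cong gf)))
    (sum-cong-≗ λ i → φ-cong (strictlyInverseˡ (f (to i)))))
    where
    lift : (Carrier → Carrier) → Fin q → Fin q
    lift h i = from (h (to i))
    lift-inv : ∀ {h k : Carrier → Carrier} → (∀ {x y} → x ≈ y → h x ≈ h y) → (∀ {x y} → x ≈ y → k x ≈ k y) →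
      (∀ x → k (h x) ≈ x) → ∀ i → lift k (lift h i) ≡ i
    lift-inv h-cong k-cong kh i = trans
      (from-cong (≈-trans (k-cong (strictlyInverseˡ _)) (kh (to i)))) (strictlyInverseʳ i)

  x-y+y≈x : ∀ x y → x -ᶠ y +ᶠ y ≈ x
  x-y+y≈x x y = ≈-trans (+-assoc x _ y) (≈-trans (+-congˡ (-‿inverseˡ y)) (+-identityʳ x))

  x+y-y≈x : ∀ x y → x +ᶠ y -ᶠ y ≈ x
  x+y-y≈x x y = ≈-trans (+-assoc x y _) (≈-trans (+-congˡ (-‿inverseʳ y)) (+-identityʳ x))

  ∫-shift : ∀ a {φ} → Resp φ → ∫ (λ x → φ (x +ᶠ a)) ≡ ∫ φ
  ∫-shift a = ∫-bij (_+ᶠ a) (_-ᶠ a) +-congʳ +-congʳ (λ x → x-y+y≈x x a) (λ x → x+y-y≈x x a)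

  ∫-neg : ∀ {φ} → Resp φ → ∫ (λ x → φ (-ᶠ x)) ≡ ∫ φ
  ∫-neg = ∫-bij -ᶠ_ -ᶠ_ -‿cong -‿cong -ᶠ-involutive -ᶠ-involutive

  ∫-scale : ∀ {u} → ¬ u ≈ 0# → ∀ {φ} → Resp φ → ∫ (λ x → φ (u *ᶠ x)) ≡ ∫ φ
  ∫-scale {u} u≉0 = ∫-bij (u *ᶠ_) (v *ᶠ_) *-congˡ *-congˡ
    (λ x → cancel x uv≈1) (λ x → cancel x (≈-trans (*-comm v u) uv≈1))
    where
    v = proj₁ (invertible u u≉0)
    uv≈1 = proj₂ (invertible u u≉0)
    cancel : ∀ {a b} x → a *ᶠ b ≈ 1# → a *ᶠ (b *ᶠ x) ≈ x
    cancel x ab≈1 = ≈-trans (≈-sym (*-assoc _ _ x)) (≈-trans (*-congʳ ab≈1) (*-identityˡ x))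

  ∫-affine : ∀ {u} → ¬ u ≈ 0# → ∀ a {φ} → Resp φ → ∫ (λ x → φ (u *ᶠ x +ᶠ a)) ≡ ∫ φ
  ∫-affine u≉0 a φ-cong = trans (∫-scale u≉0 (φ-cong ∘ +-congʳ)) (∫-shift a φ-cong)

  δ : Carrier → ℤ
  δ x = 𝟙 (x ≟ᶠ 0#)

  δ-cong : Resp δ
  δ-cong {x} {y} x≈y = 𝟙-cong (x ≟ᶠ 0#) (y ≟ᶠ 0#) (≈-trans (≈-sym x≈y)) (≈-trans x≈y)

  δ-⇔ : ∀ {x y} → (x ≈ 0# → y ≈ 0#) → (y ≈ 0# → x ≈ 0#) → δ x ≡ δ y
  δ-⇔ = 𝟙-cong (_ ≟ᶠ 0#) (_ ≟ᶠ 0#)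

  -x≈0⇒x≈0 : ∀ {x} → -ᶠ x ≈ 0# → x ≈ 0#
  -x≈0⇒x≈0 eq = ≈-trans (≈-sym (-ᶠ-involutive _)) (≈-trans (-‿cong eq) -0#≈0#)

  δ-neg : ∀ x → δ (-ᶠ x) ≡ δ x
  δ-neg x = δ-⇔ -x≈0⇒x≈0 λ x≈0 → ≈-trans (-‿cong x≈0) -0#≈0#

  δ-yes : ∀ {x} → x ≈ 0# → δ x ≡ 1ℤ
  δ-yes = 𝟙-yes (_ ≟ᶠ 0#)

  δ-no : ∀ {x} → ¬ x ≈ 0# → δ x ≡ 0ℤ
  δ-no = 𝟙-no (_ ≟ᶠ 0#)

  ∫δ : ∫ δ ≡ 1ℤ
  ∫δ = trans
    (sum-cong-≗ λ i → 𝟙-cong (to i ≟ᶠ 0#) (i Finₚ.≟ from 0#)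
      (λ eq → trans (sym (strictlyInverseʳ i)) (from-cong eq))
      (λ eq → ≈-trans (to-cong eq) (strictlyInverseˡ 0#)))
    (sum-𝟙 (from 0#))

  -- Read from right to left, this inserts a sum over a value t; exchanging sums afterwards counts
  -- the fibre over t.
  ∫-select : ∀ a {φ} → Resp φ → ∫ (λ x → δ (x -ᶠ a) * φ x) ≡ φ a
  ∫-select a {φ} φ-cong = begin
    ∫ (λ x → δ (x -ᶠ a) * φ x)   ≡⟨ ∫-cong replace ⟩
    ∫ (λ x → φ a * δ (x -ᶠ a))   ≡⟨ ∫-* (φ a) (λ x → δ (x -ᶠ a)) ⟩
    φ a * ∫ (λ x → δ (x -ᶠ a))   ≡⟨ cong (φ a *_) (trans (∫-shift (-ᶠ a) {δ} δ-cong) ∫δ) ⟩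
    φ a * 1ℤ                     ≡⟨ ℤₚ.*-identityʳ (φ a) ⟩
    φ a                          ∎
    where
    open ≡-Reasoning
    replace : ∀ x → δ (x -ᶠ a) * φ x ≡ φ a * δ (x -ᶠ a)
    replace x with (x -ᶠ a) ≟ᶠ 0#
    ... | yes eq = trans (ℤₚ.*-comm 1ℤ (φ x)) (cong (_* 1ℤ) (φ-cong (x-y≈0⇒x≈y x a eq)))
    ... | no  _  = sym (ℤₚ.*-zeroʳ (φ a))

  xy≈0⇒y≈0 : ∀ {x y} → ¬ x ≈ 0# → x *ᶠ y ≈ 0# → y ≈ 0#
  xy≈0⇒y≈0 {x} {y} x≉0 xy≈0 with invertible x x≉0
  ... | v , xv≈1 = begin
    y               ≈⟨ *-identityˡ y ⟨
    1# *ᶠ y         ≈⟨ *-congʳ (≈-trans (≈-sym xv≈1) (*-comm x v)) ⟩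
    v *ᶠ x *ᶠ y     ≈⟨ *-assoc v x y ⟩
    v *ᶠ (x *ᶠ y)   ≈⟨ *-congˡ xy≈0 ⟩
    v *ᶠ 0#         ≈⟨ zeroʳ v ⟩
    0#              ∎
    where open ≈-R

  x²≈0⇒x≈0 : ∀ {x} → x *ᶠ x ≈ 0# → x ≈ 0#
  x²≈0⇒x≈0 {x} x²≈0 with x ≟ᶠ 0#
  ... | yes x≈0 = x≈0
  ... | no  x≉0 = xy≈0⇒y≈0 x≉0 x²≈0

  x≈0⇒x²≈0 : ∀ {x} → x ≈ 0# → x *ᶠ x ≈ 0#
  x≈0⇒x²≈0 x≈0 = ≈-trans (*-congˡ x≈0) (zeroʳ _)

  x≈0⇒x+x≈0 : ∀ {x} → x ≈ 0# → x +ᶠ x ≈ 0#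
  x≈0⇒x+x≈0 x≈0 = ≈-trans (+-cong x≈0 x≈0) (+-identityˡ 0#)

  -- The quadratic character.

  η-zero : ∀ {a} → a ≈ 0# → η F a ≡ 0ℤ
  η-zero {a} a≈0 with a ≟ᶠ 0# | isSquare? F a
  ... | yes _ | _ = refl
  ... | no a≉0 | _ = contradiction a≈0 a≉0

  η-square : ∀ {a} → ¬ a ≈ 0# → IsSquare F a → η F a ≡ 1ℤ
  η-square {a} a≉0 sq with a ≟ᶠ 0# | isSquare? F a
  ... | yes a≈0 | _ = contradiction a≈0 a≉0
  ... | no _ | yes _ = refl
  ... | no _ | no ¬sq = contradiction sq ¬sq

  η-nonsquare : ∀ {a} → ¬ a ≈ 0# → ¬ IsSquare F a → η F a ≡ -1ℤ
  η-nonsquare {a} a≉0 ¬sq with a ≟ᶠ 0# | isSquare? F a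
  ... | yes a≈0 | _ = contradiction a≈0 a≉0
  ... | no _ | yes sq = contradiction sq ¬sq
  ... | no _ | no _ = refl

  -- A three-way view, so that case splits need not repeat the two decisions inside `η`.
  data QuadraticClass (a : Carrier) : Set (c ⊔ ℓ) where
    vanishing : a ≈ 0# → QuadraticClass a
    square    : ¬ a ≈ 0# → IsSquare F a → QuadraticClass a
    nonsquare : ¬ a ≈ 0# → ¬ IsSquare F a → QuadraticClass a

  classify : ∀ a → QuadraticClass a
  classify a with a ≟ᶠ 0# | isSquare? F a
  ... | yes a≈0 | _      = vanishing a≈0
  ... | no  a≉0 | yes sq = square a≉0 sq
  ... | no  a≉0 | no ¬sq = nonsquare a≉0 ¬sq

  square-cong : ∀ {a b} → a ≈ b → IsSquare F a → IsSquare F b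
  square-cong a≈b (s , s²≈a) = s , ≈-trans s²≈a a≈b

  η-⇔ : ∀ {a b} → (a ≈ 0# → b ≈ 0#) → (b ≈ 0# → a ≈ 0#) →
    (IsSquare F a → IsSquare F b) → (IsSquare F b → IsSquare F a) → η F a ≡ η F b
  η-⇔ {a} z z⁻ s s⁻ with classify a
  ... | vanishing a≈0    = trans (η-zero a≈0) (sym (η-zero (z a≈0)))
  ... | square a≉0 sq    = trans (η-square a≉0 sq) (sym (η-square (a≉0 ∘ z⁻) (s sq)))
  ... | nonsquare a≉0 ¬sq = trans (η-nonsquare a≉0 ¬sq) (sym (η-nonsquare (a≉0 ∘ z⁻) (¬sq ∘ s⁻)))

  η-cong : Resp (η F)
  η-cong a≈b = η-⇔ (≈-trans (≈-sym a≈b)) (≈-trans a≈b) (square-cong a≈b) (square-cong (≈-sym a≈b))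

  η-square-* : ∀ {u} → ¬ u ≈ 0# → ∀ t → η F (u *ᶠ u *ᶠ t) ≡ η F t
  η-square-* {u} u≉0 t with invertible u u≉0
  ... | v , uv≈1 = η-⇔
    (λ eq → xy≈0⇒y≈0 (u≉0 ∘ x²≈0⇒x≈0) eq)
    (λ t≈0 → ≈-trans (*-congˡ t≈0) (zeroʳ _))
    (λ (s , s²≈) → v *ᶠ s , (begin
      v *ᶠ s *ᶠ (v *ᶠ s)          ≈⟨ solve 2 (λ v s → v :* s :* (v :* s) := v :* v :* (s :* s)) ≈-refl v s ⟩
      v *ᶠ v *ᶠ (s *ᶠ s)          ≈⟨ *-congˡ s²≈ ⟩
      v *ᶠ v *ᶠ (u *ᶠ u *ᶠ t)     ≈⟨ solve 3 (λ u v t → v :* v :* (u :* u :* t) := u :* v :* (u :* v) :* t) ≈-refl u v t ⟩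
      u *ᶠ v *ᶠ (u *ᶠ v) *ᶠ t     ≈⟨ *-congʳ (*-cong uv≈1 uv≈1) ⟩
      1# *ᶠ 1# *ᶠ t               ≈⟨ ≈-trans (*-congʳ (*-identityˡ 1#)) (*-identityˡ t) ⟩
      t                           ∎))
    (λ (s , s²≈t) → u *ᶠ s , (begin
      u *ᶠ s *ᶠ (u *ᶠ s)          ≈⟨ solve 2 (λ v s → v :* s :* (v :* s) := v :* v :* (s :* s)) ≈-refl u s ⟩
      u *ᶠ u *ᶠ (s *ᶠ s)          ≈⟨ *-congˡ s²≈t ⟩
      u *ᶠ u *ᶠ t                 ∎))
    where open ≈-R

  -- If 1 + 1 = 0, then x ↦ x + 1 is an involution without fixed points, and q would be even.
  char≢2 : ∀ {k} → q ≡ suc (k ℕ.+ k) → ¬ 1# +ᶠ 1# ≈ 0#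
  char≢2 {k} q≡1+2k 1+1≈0
    with fixpoint-free-involution⇒even (λ i → from (to i +ᶠ 1#)) involutive free
    where
    involutive : ∀ i → from (to (from (to i +ᶠ 1#)) +ᶠ 1#) ≡ i
    involutive i = trans (from-cong (≈-trans (+-congʳ (strictlyInverseˡ _))
      (≈-trans (+-assoc (to i) 1# 1#) (≈-trans (+-congˡ 1+1≈0) (+-identityʳ _))))) (strictlyInverseʳ i)
    free : ∀ i → from (to i +ᶠ 1#) ≢ i
    free i eq = 0≉1 (begin
      0#                        ≈⟨ -‿inverseˡ (to i) ⟨
      -ᶠ (to i) +ᶠ to i             ≈⟨ +-congˡ (≈-trans (≈-reflexive (cong to (sym eq))) (strictlyInverseˡ _)) ⟩
      -ᶠ (to i) +ᶠ (to i +ᶠ 1#)     ≈⟨ +-assoc _ _ _ ⟨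
      -ᶠ (to i) +ᶠ to i +ᶠ 1#       ≈⟨ +-congʳ (-‿inverseˡ (to i)) ⟩
      0# +ᶠ 1#                  ≈⟨ +-identityˡ 1# ⟩
      1#                        ∎)
      where open ≈-R
  ... | m , eq = odd≢even k ℤ.∣ m ∣ (trans (sym q≡1+2k) (trans (cong ℤ.∣_∣ eq) (abs-double m)))
    where
    abs-double : ∀ m → ℤ.∣ m + m ∣ ≡ ℤ.∣ m ∣ ℕ.+ ℤ.∣ m ∣
    abs-double (ℤ.+ n)    = refl
    abs-double ℤ.-[1+ n ] = cong suc (sym (ℕₚ.+-suc n n))
    odd≢even : ∀ k m → suc (k ℕ.+ k) ≢ m ℕ.+ m
    odd≢even zero    (suc m) eq with () ← trans (ℕₚ.suc-injective eq) (ℕₚ.+-suc m m)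
    odd≢even (suc k) (suc m) eq = odd≢even k m (ℕₚ.suc-injective (ℕₚ.suc-injective
      (trans (cong (λ j → suc (suc j)) (sym (ℕₚ.+-suc k k))) (trans eq (cong suc (ℕₚ.+-suc m m))))))

  -- Counting with the quadratic character in odd characteristic.

  module OddCharacteristic (2≉0 : ¬ (1# +ᶠ 1#) ≈ 0#) where

    x+x≈0⇒x≈0 : ∀ {x} → x +ᶠ x ≈ 0# → x ≈ 0#
    x+x≈0⇒x≈0 {x} eq = xy≈0⇒y≈0 2≉0
      (≈-trans (distribʳ x 1# 1#) (≈-trans (+-cong (*-identityˡ x) (*-identityˡ x)) eq))

    root-factor : ∀ {a b} → b *ᶠ b ≈ a → ∀ s → (s +ᶠ b) *ᶠ (s -ᶠ b) ≈ s *ᶠ s -ᶠ a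
    root-factor {a} {b} b²≈a s = begin
      (s +ᶠ b) *ᶠ (s -ᶠ b)                              ≈⟨ distribʳ (s -ᶠ b) s b ⟩
      s *ᶠ (s -ᶠ b) +ᶠ b *ᶠ (s -ᶠ b)                    ≈⟨ +-cong (x[y-z]≈xy-xz s s b) (x[y-z]≈xy-xz b s b) ⟩
      s *ᶠ s -ᶠ s *ᶠ b +ᶠ (b *ᶠ s -ᶠ b *ᶠ b)            ≈⟨ +-congˡ (+-cong (*-comm b s) (-‿cong b²≈a)) ⟩
      s *ᶠ s -ᶠ s *ᶠ b +ᶠ (s *ᶠ b -ᶠ a)                 ≈⟨ +-assoc _ _ _ ⟨
      s *ᶠ s -ᶠ s *ᶠ b +ᶠ s *ᶠ b -ᶠ a                   ≈⟨ +-congʳ (x-y+y≈x (s *ᶠ s) (s *ᶠ b)) ⟩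
      s *ᶠ s -ᶠ a                                       ∎
      where open ≈-R

    -- For a nonzero square the roots are b and -b, which differ because 2 ≠ 0; the other two
    -- classes have one root and none.
    ∫-roots : ∀ a → ∫ (λ s → δ (s *ᶠ s -ᶠ a)) ≡ 1ℤ + η F a
    ∫-roots a with classify a
    ... | vanishing a≈0 = trans (∫-cong λ s → δ-⇔ (zero⇒ s) (⇒zero s)) (trans ∫δ (cong (λ z → 1ℤ + z) (sym (η-zero a≈0))))
      where
      s²-a≈s² : ∀ s → s *ᶠ s -ᶠ a ≈ s *ᶠ s
      s²-a≈s² s = ≈-trans (+-congˡ (≈-trans (-‿cong a≈0) -0#≈0#)) (+-identityʳ _)
      zero⇒ : ∀ s → s *ᶠ s -ᶠ a ≈ 0# → s ≈ 0#
      zero⇒ s eq = x²≈0⇒x≈0 (≈-trans (≈-sym (s²-a≈s² s)) eq)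
      ⇒zero : ∀ s → s ≈ 0# → s *ᶠ s -ᶠ a ≈ 0#
      ⇒zero s s≈0 = ≈-trans (s²-a≈s² s) (x≈0⇒x²≈0 s≈0)
    ... | nonsquare a≉0 ¬sq = trans (∫-cong λ s → δ-no λ eq → ¬sq (s , x-y≈0⇒x≈y _ a eq))
            (trans (∫-const 0ℤ) (trans (ℤₚ.*-zeroʳ (ℤ.+ q)) (cong (λ z → 1ℤ + z) (sym (η-nonsquare a≉0 ¬sq)))))
    ... | square a≉0 sq@(b , b²≈a) = begin
      ∫ (λ s → δ (s *ᶠ s -ᶠ a))                      ≡⟨ ∫-cong two-roots ⟩
      ∫ (λ s → δ (s +ᶠ b) + δ (s -ᶠ b))              ≡⟨ ∫-+ (λ s → δ (s +ᶠ b)) (λ s → δ (s -ᶠ b)) ⟩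
      ∫ (λ s → δ (s +ᶠ b)) + ∫ (λ s → δ (s -ᶠ b))    ≡⟨ cong₂ _+_ (∫-shift b {δ} δ-cong) (∫-shift (-ᶠ b) {δ} δ-cong) ⟩
      ∫ δ + ∫ δ                                      ≡⟨ cong₂ _+_ ∫δ ∫δ ⟩
      1ℤ + 1ℤ                                        ≡⟨ cong (λ z → 1ℤ + z) (η-square a≉0 sq) ⟨
      1ℤ + η F a                                     ∎
      where
      open ≡-Reasoning
      b≉0 : ¬ b ≈ 0#
      b≉0 b≈0 = a≉0 (≈-trans (≈-sym b²≈a) (x≈0⇒x²≈0 b≈0))
      two-roots : ∀ s → δ (s *ᶠ s -ᶠ a) ≡ δ (s +ᶠ b) + δ (s -ᶠ b)
      two-roots s with (s +ᶠ b) ≟ᶠ 0# | (s -ᶠ b) ≟ᶠ 0#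
      -- The roots cannot coincide: s = b = -b would give b + b = 0.
      ... | yes s≈-b | yes s≈b = ⊥-elim (b≉0 (x+x≈0⇒x≈0 (≈-trans (+-congʳ (≈-sym (x-y≈0⇒x≈y s b s≈b))) s≈-b)))
      ... | yes s≈-b | no _    = δ-yes (≈-trans (≈-sym (root-factor b²≈a s)) (≈-trans (*-congʳ s≈-b) (zeroˡ _)))
      ... | no _     | yes s≈b = δ-yes (≈-trans (≈-sym (root-factor b²≈a s)) (≈-trans (*-congˡ s≈b) (zeroʳ _)))
      ... | no s≉-b  | no s≉b  = δ-no λ eq → s≉b (xy≈0⇒y≈0 s≉-b (≈-trans (root-factor b²≈a s) eq))

    ∫-swap : ∀ (f : Carrier → Carrier → ℤ) → ∫ (λ x → ∫ (λ y → f x y)) ≡ ∫ (λ y → ∫ (λ x → f x y))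
    ∫-swap f = ∑-comm λ i j → f (to i) (to j)

    ∫-*ʳ : ∀ k φ → ∫ (λ x → φ x * k) ≡ ∫ φ * k
    ∫-*ʳ k φ = trans (∫-cong λ x → ℤₚ.*-comm (φ x) k) (trans (∫-* k φ) (ℤₚ.*-comm k (∫ φ)))

    ∫1 : ∫ (λ _ → 1ℤ) ≡ ℤ.+ q
    ∫1 = trans (∫-const 1ℤ) (ℤₚ.*-identityʳ (ℤ.+ q))

    δ-sym : ∀ x y → δ (x -ᶠ y) ≡ δ (y -ᶠ x)
    δ-sym x y = trans (δ-cong (≈-sym (-[x-y]≈y-x y x))) (δ-neg (y -ᶠ x))

    -- Sorts s by the value t of its square; `∫-roots` gives the size of each fibre.
    ∫-square : ∀ {φ} → Resp φ → ∫ (λ s → φ (s *ᶠ s)) ≡ ∫ (λ t → (1ℤ + η F t) * φ t)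
    ∫-square {φ} φ-cong = begin
      ∫ (λ s → φ (s *ᶠ s))                              ≡⟨ ∫-cong (λ s → ∫-select (s *ᶠ s) φ-cong) ⟨
      ∫ (λ s → ∫ (λ t → δ (t -ᶠ s *ᶠ s) * φ t))         ≡⟨ ∫-swap (λ s t → δ (t -ᶠ s *ᶠ s) * φ t) ⟩
      ∫ (λ t → ∫ (λ s → δ (t -ᶠ s *ᶠ s) * φ t))         ≡⟨ ∫-cong (λ t → ∫-cong λ s → cong (_* φ t) (δ-sym t (s *ᶠ s))) ⟩
      ∫ (λ t → ∫ (λ s → δ (s *ᶠ s -ᶠ t) * φ t))         ≡⟨ ∫-cong (λ t → ∫-*ʳ (φ t) (λ s → δ (s *ᶠ s -ᶠ t))) ⟩
      ∫ (λ t → ∫ (λ s → δ (s *ᶠ s -ᶠ t)) * φ t)         ≡⟨ ∫-cong (λ t → cong (_* φ t) (∫-roots t)) ⟩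
      ∫ (λ t → (1ℤ + η F t) * φ t)                      ∎
      where open ≡-Reasoning

    -- The fibres of squaring, of sizes 1 + η t, together exhaust the q elements.
    ∫η : ∫ (η F) ≡ 0ℤ
    ∫η = ℤ-+-cancelˡ (ℤ.+ q * 1ℤ) _ _ (begin
      ℤ.+ q * 1ℤ + ∫ (η F)              ≡⟨ cong (_+ ∫ (η F)) (∫-const 1ℤ) ⟨
      ∫ (λ _ → 1ℤ) + ∫ (η F)            ≡⟨ ∫-+ (λ _ → 1ℤ) (η F) ⟨
      ∫ (λ t → 1ℤ + η F t)              ≡⟨ ∫-cong (λ t → ℤₚ.*-identityʳ (1ℤ + η F t)) ⟨
      ∫ (λ t → (1ℤ + η F t) * 1ℤ)       ≡⟨ ∫-square {λ _ → 1ℤ} (λ _ → refl) ⟨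
      ∫ (λ s → 1ℤ)                      ≡⟨ ∫-const 1ℤ ⟩
      ℤ.+ q * 1ℤ                        ≡⟨ ℤₚ.+-identityʳ _ ⟨
      ℤ.+ q * 1ℤ + 0ℤ                   ∎)
      where open ≡-Reasoning

    -- For a nonsquare m every η t + η (m t) is at most 0, and these terms sum to 0.
    η-* : ∀ {m} → ¬ m ≈ 0# → ∀ t → η F (m *ᶠ t) ≡ η F m * η F t
    η-* {m} m≉0 t with classify m
    ... | vanishing m≈0 = contradiction m≈0 m≉0
    ... | square _ sq@(u , u²≈m) = begin
      η F (m *ᶠ t)          ≡⟨ η-cong (*-congʳ (≈-sym u²≈m)) ⟩
      η F (u *ᶠ u *ᶠ t)     ≡⟨ η-square-* (λ u≈0 → m≉0 (≈-trans (≈-sym u²≈m) (x≈0⇒x²≈0 u≈0))) t ⟩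
      η F t                 ≡⟨ ℤₚ.*-identityˡ (η F t) ⟨
      1ℤ * η F t            ≡⟨ cong (_* η F t) (η-square m≉0 sq) ⟨
      η F m * η F t         ∎
      where open ≡-Reasoning
    ... | nonsquare _ ¬sq = trans (negate _ _ (everywhere t)) (cong (_* η F t) (sym (η-nonsquare m≉0 ¬sq)))
      where
      negate : ∀ x y → x + y ≡ 0ℤ → y ≡ -1ℤ * x
      negate x y eq = trans (lem x y) (trans (cong (_+ -1ℤ * x) eq) (ℤₚ.+-identityˡ _))
        where
        lem : ∀ x y → y ≡ x + y + -1ℤ * x
        lem = solve-∀
      h : Carrier → ℤ
      h t = η F t + η F (m *ᶠ t)
      h-cong : Resp h
      h-cong eq = cong₂ _+_ (η-cong eq) (η-cong (*-congˡ eq))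
      η≤1 : ∀ a → η F a ≤ 1ℤ
      η≤1 a with classify a
      ... | vanishing a≈0     = ℤₚ.≤-trans (ℤₚ.≤-reflexive (η-zero a≈0)) (+≤+ ℕ.z≤n)
      ... | square a≉0 sq     = ℤₚ.≤-reflexive (η-square a≉0 sq)
      ... | nonsquare a≉0 ¬sq = ℤₚ.≤-trans (ℤₚ.≤-reflexive (η-nonsquare a≉0 ¬sq)) -≤+
      h≤0 : ∀ t → h t ≤ 0ℤ
      h≤0 t with classify t
      ... | vanishing t≈0 = ℤₚ.≤-reflexive (cong₂ _+_ (η-zero t≈0) (η-zero (≈-trans (*-congˡ t≈0) (zeroʳ m))))
      ... | nonsquare t≉0 ¬sqt = ℤₚ.≤-trans (ℤₚ.≤-reflexive (cong (_+ η F (m *ᶠ t)) (η-nonsquare t≉0 ¬sqt)))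
                                   (ℤₚ.+-monoʳ-≤ -1ℤ (η≤1 (m *ᶠ t)))
      ... | square t≉0 sqt@(b , b²≈t) = ℤₚ.≤-reflexive (cong₂ _+_ (η-square t≉0 sqt)
              (trans (η-cong (≈-trans (*-comm m t) (*-congʳ (≈-sym b²≈t))))
                (trans (η-square-* (λ b≈0 → t≉0 (≈-trans (≈-sym b²≈t) (x≈0⇒x²≈0 b≈0))) m) (η-nonsquare m≉0 ¬sq))))
      ∫h : ∫ h ≡ 0ℤ
      ∫h = trans (∫-+ (η F) (λ t → η F (m *ᶠ t))) (cong₂ _+_ ∫η (trans (∫-scale m≉0 {η F} η-cong) ∫η))
      everywhere : ∀ t → h t ≡ 0ℤ
      everywhere t = trans (h-cong (≈-sym (strictlyInverseˡ t))) (sum-zero⁻ (h≤0 ∘ to) ∫h (from t))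

    expand-square : ∀ x s b → (x +ᶠ s) *ᶠ (x +ᶠ s) -ᶠ (s *ᶠ s +ᶠ b) ≈ (x +ᶠ x) *ᶠ s +ᶠ (x *ᶠ x -ᶠ b)
    expand-square x s b = begin
      (x +ᶠ s) *ᶠ (x +ᶠ s) -ᶠ (s *ᶠ s +ᶠ b)
        ≈⟨ +-congˡ (-‿+-comm (s *ᶠ s) b) ⟨
      (x +ᶠ s) *ᶠ (x +ᶠ s) +ᶠ (-ᶠ (s *ᶠ s) -ᶠ b)
        ≈⟨ solve 4 (λ x s m n → (x :+ s) :* (x :+ s) :+ (m :+ n) := s :* s :+ m :+ ((x :+ x) :* s :+ (x :* x :+ n)))
             ≈-refl x s (-ᶠ (s *ᶠ s)) (-ᶠ b) ⟩
      s *ᶠ s -ᶠ s *ᶠ s +ᶠ ((x +ᶠ x) *ᶠ s +ᶠ (x *ᶠ x -ᶠ b))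
        ≈⟨ ≈-trans (+-congʳ (-‿inverseʳ (s *ᶠ s))) (+-identityˡ _) ⟩
      (x +ᶠ x) *ᶠ s +ᶠ (x *ᶠ x -ᶠ b) ∎
      where open ≈-R

    -- Counts r² = s² + a; with r = x + s the equation becomes linear in s.
    ∫η-square+ : ∀ a → ∫ (λ s → η F (s *ᶠ s +ᶠ a)) ≡ ℤ.+ q * δ a - 1ℤ
    ∫η-square+ a = shuffle (begin
      ℤ.+ q + ∫ (λ s → η F (s *ᶠ s +ᶠ a))
        ≡⟨ cong (_+ ∫ (λ s → η F (s *ᶠ s +ᶠ a))) ∫1 ⟨
      ∫ (λ s → 1ℤ) + ∫ (λ s → η F (s *ᶠ s +ᶠ a))
        ≡⟨ ∫-+ (λ _ → 1ℤ) (λ s → η F (s *ᶠ s +ᶠ a)) ⟨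
      ∫ (λ s → 1ℤ + η F (s *ᶠ s +ᶠ a))
        ≡⟨ ∫-cong (λ s → ∫-roots (s *ᶠ s +ᶠ a)) ⟨
      ∫ (λ s → ∫ (λ r → δ (r *ᶠ r -ᶠ (s *ᶠ s +ᶠ a))))
        ≡⟨ ∫-cong (λ s → ∫-shift s {λ r → δ (r *ᶠ r -ᶠ (s *ᶠ s +ᶠ a))} λ eq → δ-cong (+-congʳ (*-cong eq eq))) ⟨
      ∫ (λ s → ∫ (λ x → δ ((x +ᶠ s) *ᶠ (x +ᶠ s) -ᶠ (s *ᶠ s +ᶠ a))))
        ≡⟨ ∫-cong (λ s → ∫-cong λ x → δ-cong (expand-square x s a)) ⟩
      ∫ (λ s → ∫ (λ x → δ ((x +ᶠ x) *ᶠ s +ᶠ (x *ᶠ x -ᶠ a))))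
        ≡⟨ ∫-swap (λ s x → δ ((x +ᶠ x) *ᶠ s +ᶠ (x *ᶠ x -ᶠ a))) ⟩
      ∫ (λ x → ∫ (λ s → δ ((x +ᶠ x) *ᶠ s +ᶠ (x *ᶠ x -ᶠ a))))
        ≡⟨ ∫-cong inner ⟩
      ∫ (λ x → 1ℤ + (ℤ.+ q * δ a - 1ℤ) * δ x)
        ≡⟨ trans (∫-+ (λ _ → 1ℤ) (λ x → (ℤ.+ q * δ a - 1ℤ) * δ x))
             (cong₂ _+_ ∫1 (∫-* (ℤ.+ q * δ a - 1ℤ) δ)) ⟩
      ℤ.+ q + (ℤ.+ q * δ a - 1ℤ) * ∫ δ
        ≡⟨ cong (λ z → ℤ.+ q + (ℤ.+ q * δ a - 1ℤ) * z) ∫δ ⟩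
      ℤ.+ q + (ℤ.+ q * δ a - 1ℤ) * 1ℤ  ∎)
      where
      open ≡-Reasoning
      shuffle : ∀ {y z} → ℤ.+ q + y ≡ ℤ.+ q + z * 1ℤ → y ≡ z
      shuffle eq = trans (ℤ-+-cancelˡ (ℤ.+ q) _ _ eq) (ℤₚ.*-identityʳ _)
      lem₁ : ∀ q d → q * d ≡ 1ℤ + (q * d - 1ℤ) * 1ℤ
      lem₁ = solve-∀
      lem₀ : ∀ q d → 1ℤ ≡ 1ℤ + (q * d - 1ℤ) * 0ℤ
      lem₀ = solve-∀
      inner : ∀ x → ∫ (λ s → δ ((x +ᶠ x) *ᶠ s +ᶠ (x *ᶠ x -ᶠ a))) ≡ 1ℤ + (ℤ.+ q * δ a - 1ℤ) * δ x
      inner x with x ≟ᶠ 0#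
      ... | yes x≈0 = trans (∫-cong λ s → trans (δ-cong (constant s)) (δ-neg a)) (trans (∫-const (δ a)) (lem₁ (ℤ.+ q) (δ a)))
        where
        constant : ∀ s → (x +ᶠ x) *ᶠ s +ᶠ (x *ᶠ x -ᶠ a) ≈ -ᶠ a
        constant s = ≈-trans (+-cong (≈-trans (*-congʳ (x≈0⇒x+x≈0 x≈0)) (zeroˡ s)) (+-congʳ (x≈0⇒x²≈0 x≈0)))
                       (≈-trans (+-identityˡ _) (+-identityˡ _))
      ... | no x≉0 = trans (∫-affine (x≉0 ∘ x+x≈0⇒x≈0) (x *ᶠ x -ᶠ a) {δ} δ-cong) (trans ∫δ (lem₀ (ℤ.+ q) (δ a)))

    ε : ℤ
    ε = η F (-ᶠ 1#)

    -1*x≈-x : ∀ x → -ᶠ 1# *ᶠ x ≈ -ᶠ x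
    -1*x≈-x x = ≈-trans (≈-sym (-‿distribˡ-* 1# x)) (-‿cong (*-identityˡ x))

    -1≉0 : ¬ -ᶠ 1# ≈ 0#
    -1≉0 eq = 0≉1 (≈-sym (-x≈0⇒x≈0 eq))

    η-neg : ∀ t → η F (-ᶠ t) ≡ ε * η F t
    η-neg t = trans (η-cong (≈-sym (-1*x≈-x t))) (η-* -1≉0 t)

    ε≡±1 : (ε ≡ 1ℤ) ⊎ (ε ≡ -1ℤ)
    ε≡±1 with classify (-ᶠ 1#)
    ... | vanishing eq      = contradiction eq -1≉0
    ... | square a≉0 sq     = inj₁ (η-square a≉0 sq)
    ... | nonsquare a≉0 ¬sq = inj₂ (η-nonsquare a≉0 ¬sq)

    ∫η-−square : ∀ a → ∫ (λ s → η F (a -ᶠ s *ᶠ s)) ≡ ε * (ℤ.+ q * δ a - 1ℤ)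
    ∫η-−square a = begin
      ∫ (λ s → η F (a -ᶠ s *ᶠ s))             ≡⟨ ∫-cong (λ s → trans (η-cong (≈-sym (-[x-y]≈y-x (s *ᶠ s) a))) (η-neg (s *ᶠ s -ᶠ a))) ⟩
      ∫ (λ s → ε * η F (s *ᶠ s -ᶠ a))         ≡⟨ ∫-* ε (λ s → η F (s *ᶠ s -ᶠ a)) ⟩
      ε * ∫ (λ s → η F (s *ᶠ s -ᶠ a))         ≡⟨ cong (ε *_) (∫η-square+ (-ᶠ a)) ⟩
      ε * (ℤ.+ q * δ (-ᶠ a) - 1ℤ)             ≡⟨ cong (λ z → ε * (ℤ.+ q * z - 1ℤ)) (δ-neg a) ⟩
      ε * (ℤ.+ q * δ a - 1ℤ)                  ∎
      where open ≡-Reasoning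

    two-squares : ∀ u → ∫ (λ s → ∫ (λ r → δ (r *ᶠ r -ᶠ (u -ᶠ s *ᶠ s)))) ≡ (ℤ.+ q - ε) + ε * ℤ.+ q * δ u
    two-squares u = begin
      ∫ (λ s → ∫ (λ r → δ (r *ᶠ r -ᶠ (u -ᶠ s *ᶠ s))))   ≡⟨ ∫-cong (λ s → ∫-roots (u -ᶠ s *ᶠ s)) ⟩
      ∫ (λ s → 1ℤ + η F (u -ᶠ s *ᶠ s))                  ≡⟨ ∫-+ (λ _ → 1ℤ) (λ s → η F (u -ᶠ s *ᶠ s)) ⟩
      ∫ (λ s → 1ℤ) + ∫ (λ s → η F (u -ᶠ s *ᶠ s))        ≡⟨ cong₂ _+_ (∫-const 1ℤ) (∫η-−square u) ⟩
      ℤ.+ q * 1ℤ + ε * (ℤ.+ q * δ u - 1ℤ)               ≡⟨ lem (ℤ.+ q) ε (δ u) ⟩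
      (ℤ.+ q - ε) + ε * ℤ.+ q * δ u                     ∎
      where
      open ≡-Reasoning
      lem : ∀ q e d → q * 1ℤ + e * (q * d - 1ℤ) ≡ (q - e) + e * q * d
      lem = solve-∀

    -- The operator that adds the square of a new coordinate to the norm.

    H : (Carrier → ℤ) → Carrier → ℤ
    H φ c = ∫ λ s → φ (s *ᶠ s +ᶠ c)

    H-cong : ∀ {φ} → Resp φ → Resp (H φ)
    H-cong φ-cong eq = ∫-cong λ s → φ-cong (+-congˡ {s *ᶠ s} eq)

    ∫H : ∀ {φ} → Resp φ → ∫ (H φ) ≡ ℤ.+ q * ∫ φ
    ∫H {φ} φ-cong = begin
      ∫ (λ c → ∫ (λ s → φ (s *ᶠ s +ᶠ c)))   ≡⟨ ∫-swap (λ c s → φ (s *ᶠ s +ᶠ c)) ⟩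
      ∫ (λ s → ∫ (λ c → φ (s *ᶠ s +ᶠ c)))   ≡⟨ ∫-cong (λ s → trans (∫-cong λ c → φ-cong (+-comm (s *ᶠ s) c)) (∫-shift (s *ᶠ s) φ-cong)) ⟩
      ∫ (λ s → ∫ φ)                         ≡⟨ ∫-const (∫ φ) ⟩
      ℤ.+ q * ∫ φ                           ∎
      where open ≡-Reasoning

    -- Sorting (s , r) by t = r² + s² + c leads to `two-squares` at t - c: all values t are hit
    -- equally often, except t = c. So two coordinates act as ε q times the identity plus a multiple
    -- of the total, which is the substitute for Fourier inversion.
    H² : ∀ {φ} → Resp φ → ∀ c → H (H φ) c ≡ (ℤ.+ q - ε) * ∫ φ + ε * ℤ.+ q * φ c
    H² {φ} φ-cong c = begin
      ∫ (λ s → ∫ (λ r → φ (r *ᶠ r +ᶠ (s *ᶠ s +ᶠ c))))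
        ≡⟨ ∫-cong (λ s → ∫-cong λ r → ∫-select (r *ᶠ r +ᶠ (s *ᶠ s +ᶠ c)) φ-cong) ⟨
      ∫ (λ s → ∫ (λ r → ∫ (λ t → δ (t -ᶠ (r *ᶠ r +ᶠ (s *ᶠ s +ᶠ c))) * φ t)))
        ≡⟨ ∫-cong (λ s → ∫-cong λ r → ∫-cong λ t → cong (_* φ t) (move r s t)) ⟩
      ∫ (λ s → ∫ (λ r → ∫ (λ t → k s r t * φ t)))
        ≡⟨ ∫-cong (λ s → ∫-swap λ r t → k s r t * φ t) ⟩
      ∫ (λ s → ∫ (λ t → ∫ (λ r → k s r t * φ t)))
        ≡⟨ ∫-swap (λ s t → ∫ λ r → k s r t * φ t) ⟩
      ∫ (λ t → ∫ (λ s → ∫ (λ r → k s r t * φ t)))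
        ≡⟨ ∫-cong (λ t → trans (∫-cong λ s → ∫-*ʳ (φ t) (λ r → k s r t)) (∫-*ʳ (φ t) (λ s → ∫ λ r → k s r t))) ⟩
      ∫ (λ t → ∫ (λ s → ∫ (λ r → k s r t)) * φ t)
        ≡⟨ ∫-cong (λ t → trans (cong (_* φ t) (two-squares (t -ᶠ c))) (lem (ℤ.+ q) ε (δ (t -ᶠ c)) (φ t))) ⟩
      ∫ (λ t → (ℤ.+ q - ε) * φ t + ε * ℤ.+ q * (δ (t -ᶠ c) * φ t))
        ≡⟨ ∫-+ (λ t → (ℤ.+ q - ε) * φ t) (λ t → ε * ℤ.+ q * (δ (t -ᶠ c) * φ t)) ⟩
      ∫ (λ t → (ℤ.+ q - ε) * φ t) + ∫ (λ t → ε * ℤ.+ q * (δ (t -ᶠ c) * φ t))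
        ≡⟨ cong₂ _+_ (∫-* (ℤ.+ q - ε) φ) (trans (∫-* (ε * ℤ.+ q) (λ t → δ (t -ᶠ c) * φ t)) (cong (ε * ℤ.+ q *_) (∫-select c φ-cong))) ⟩
      (ℤ.+ q - ε) * ∫ φ + ε * ℤ.+ q * φ c ∎
      where
      open ≡-Reasoning
      k : Carrier → Carrier → Carrier → ℤ
      k s r t = δ (r *ᶠ r -ᶠ (t -ᶠ c -ᶠ s *ᶠ s))
      lem : ∀ q e d f → ((q - e) + e * q * d) * f ≡ (q - e) * f + e * q * (d * f)
      lem = solve-∀
      move : ∀ r s t → δ (t -ᶠ (r *ᶠ r +ᶠ (s *ᶠ s +ᶠ c))) ≡ k s r t
      move r s t = trans (δ-sym t (r *ᶠ r +ᶠ (s *ᶠ s +ᶠ c))) (δ-cong (F.begin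
        r *ᶠ r +ᶠ (s *ᶠ s +ᶠ c) -ᶠ t        F.≈⟨ +-assoc _ _ _ ⟩
        r *ᶠ r +ᶠ (s *ᶠ s +ᶠ c -ᶠ t)        F.≈⟨ +-congˡ (≈-trans (+-assoc _ _ _) (+-congˡ (≈-sym (-[x-y]≈y-x t c)))) ⟩
        r *ᶠ r +ᶠ (s *ᶠ s -ᶠ (t -ᶠ c))      F.≈⟨ +-congˡ (-[x-y]≈y-x (t -ᶠ c) (s *ᶠ s)) ⟨
        r *ᶠ r -ᶠ (t -ᶠ c -ᶠ s *ᶠ s)        F.∎))
        where module F = ≈-R

    Q : ℤ
    Q = ℤ.+ q

    -- The d-th iterate is c ↦ Σ_ξ φ(‖ξ‖ + c), so sums over F^d of a function of the norm obey a
    -- recursion in one variable.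
    H^ : ℕ → (Carrier → ℤ) → Carrier → ℤ
    H^ zero    φ = φ
    H^ (suc k) φ = H (H^ k φ)

    H^-cong : ∀ k {φ} → Resp φ → Resp (H^ k φ)
    H^-cong zero    φ-cong = φ-cong
    H^-cong (suc k) φ-cong = H-cong (H^-cong k φ-cong)

    ∫H^ : ∀ k {φ} → Resp φ → ∫ (H^ k φ) ≡ Q ℤ.^ k * ∫ φ
    ∫H^ zero    φ-cong = sym (ℤₚ.*-identityˡ _)
    ∫H^ (suc k) φ-cong = trans (∫H (H^-cong k φ-cong)) (trans (cong (Q *_) (∫H^ k φ-cong)) (sym (ℤₚ.*-assoc Q _ _)))

    -- Each pair of coordinates multiplies the deviation from the mean,
    -- `Q * H^ n φ c - Q ℤ.^ n * ∫ φ`, by ε Q. The factor Q on both sides avoids the exponent n - 1,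
    -- and b counts the coordinates left unpaired.
    H^-closed : ∀ b k {φ} → Resp φ → ∀ c →
      Q * H^ (k ℕ.* 2 ℕ.+ b) φ c ≡
      (ε * Q) ℤ.^ k * (Q * H^ b φ c) + (Q ℤ.^ (k ℕ.* 2 ℕ.+ b) - (ε * Q) ℤ.^ k * Q ℤ.^ b) * ∫ φ
    H^-closed b zero {φ} φ-cong c = lem (Q * H^ b φ c) (Q ℤ.^ b) (∫ φ)
      where
      lem : ∀ h p w → h ≡ 1ℤ * h + (p - 1ℤ * p) * w
      lem = solve-∀
    H^-closed b (suc k) {φ} φ-cong c = begin
      Q * H (H (H^ n φ)) c
        ≡⟨ cong (Q *_) (H² (H^-cong n φ-cong) c) ⟩
      Q * ((Q - ε) * ∫ (H^ n φ) + ε * Q * H^ n φ c)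
        ≡⟨ cong (λ z → Q * ((Q - ε) * z + ε * Q * H^ n φ c)) (∫H^ n φ-cong) ⟩
      Q * ((Q - ε) * (Q ℤ.^ n * ∫ φ) + ε * Q * H^ n φ c)
        ≡⟨ lem₁ Q ε (Q ℤ.^ n) (∫ φ) (H^ n φ c) ⟩
      Q * (Q - ε) * Q ℤ.^ n * ∫ φ + ε * Q * (Q * H^ n φ c)
        ≡⟨ cong (λ z → Q * (Q - ε) * Q ℤ.^ n * ∫ φ + ε * Q * z) (H^-closed b k φ-cong c) ⟩
      Q * (Q - ε) * Q ℤ.^ n * ∫ φ + ε * Q * (E * (Q * H^ b φ c) + (Q ℤ.^ n - E * Q ℤ.^ b) * ∫ φ)
        ≡⟨ lem₂ Q ε (Q ℤ.^ n) (∫ φ) E (H^ b φ c) (Q ℤ.^ b) ⟩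
      ε * Q * E * (Q * H^ b φ c) + (Q * (Q * Q ℤ.^ n) - ε * Q * E * Q ℤ.^ b) * ∫ φ
        ∎
      where
      open ≡-Reasoning
      n = k ℕ.* 2 ℕ.+ b
      E = (ε * Q) ℤ.^ k
      lem₁ : ∀ q e p w h → q * ((q - e) * (p * w) + e * q * h) ≡ q * (q - e) * p * w + e * q * (q * h)
      lem₁ = solve-∀
      lem₂ : ∀ q e p w E h r → q * (q - e) * p * w + e * q * (E * (q * h) + (p - E * r) * w)
           ≡ e * q * E * (q * h) + (q * (q * p) - e * q * E * r) * w
      lem₂ = solve-∀

    sum-multiple : ∀ {n} (k : ℤ) {f : Fin n → ℤ} → (∀ i → ∃ λ m → f i ≡ k * m) → ∃ λ m → sum f ≡ k * m
    sum-multiple k mult = sum (proj₁ ∘ mult) , trans (sum-cong-≗ (proj₂ ∘ mult)) (sum-*ˡ k (proj₁ ∘ mult))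

    -- Σ_u (1 + η u)(1 + η (1 − u)) = #{s² + t² = 1}: the terms u = 0 and u = 1 are 2, the others 0 or 4.
    q-ε+4-multiple : ∃ λ m → Q - ε + ℤ.+ 4 ≡ ℤ.+ 4 * m
    q-ε+4-multiple = proj₁ total , trans (sym count) (proj₂ total)
      where
      open ≡-Reasoning
      two : ℤ
      two = ℤ.+ 2
      f g : Carrier → ℤ
      f u = (1ℤ + η F u) * (1ℤ + η F (1# -ᶠ u))
      g u = two * δ u + two * δ (u -ᶠ 1#)
      count : ∫ (λ u → f u + g u) ≡ Q - ε + ℤ.+ 4
      count = begin
        ∫ (λ u → f u + g u)  ≡⟨ ∫-+ f g ⟩
        ∫ f + ∫ g
          ≡⟨ cong₂ _+_
               (trans (sym (∫-square {λ u → 1ℤ + η F (1# -ᶠ u)} λ eq → cong (λ z → 1ℤ + z) (η-cong (+-congˡ (-‿cong eq)))))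
                 (trans (∫-+ (λ _ → 1ℤ) (λ s → η F (1# -ᶠ s *ᶠ s))) (cong₂ _+_ ∫1 (∫η-−square 1#))))
               (trans (∫-+ (λ u → two * δ u) (λ u → two * δ (u -ᶠ 1#))) (cong₂ _+_ (∫-* two δ) (∫-* two (λ u → δ (u -ᶠ 1#))))) ⟩
        Q + ε * (Q * δ 1# - 1ℤ) + (two * ∫ δ + two * ∫ (λ u → δ (u -ᶠ 1#)))
          ≡⟨ cong₂ _+_ (cong (λ z → Q + ε * (Q * z - 1ℤ)) (δ-no (0≉1 ∘ ≈-sym)))
               (cong₂ (λ y z → two * y + two * z) ∫δ (trans (∫-shift (-ᶠ 1#) {δ} δ-cong) ∫δ)) ⟩
        Q + ε * (Q * 0ℤ - 1ℤ) + ℤ.+ 4   ≡⟨ lem Q ε ⟩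
        Q - ε + ℤ.+ 4                   ∎
        where
        lem : ∀ q e → q + e * (q * 0ℤ - 1ℤ) + ℤ.+ 4 ≡ q - e + ℤ.+ 4
        lem = solve-∀
      η≉0 : ∀ a → ¬ a ≈ 0# → ∃ λ m → 1ℤ + η F a ≡ two * m
      η≉0 a a≉0 with classify a
      ... | vanishing a≈0  = contradiction a≈0 a≉0
      ... | square _ sq    = 1ℤ , cong (λ z → 1ℤ + z) (η-square a≉0 sq)
      ... | nonsquare _ ¬sq = 0ℤ , cong (λ z → 1ℤ + z) (η-nonsquare a≉0 ¬sq)
      η1 : η F 1# ≡ 1ℤ
      η1 = η-square (0≉1 ∘ ≈-sym) (1# , *-identityˡ 1#)
      evaluate : ∀ {u y z k l} → 1ℤ + η F u ≡ y → 1ℤ + η F (1# -ᶠ u) ≡ z → δ u ≡ k → δ (u -ᶠ 1#) ≡ l →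
        f u + g u ≡ y * z + (two * k + two * l)
      evaluate eq₁ eq₂ eq₃ eq₄ = cong₂ _+_ (cong₂ _*_ eq₁ eq₂) (cong₂ (λ k l → two * k + two * l) eq₃ eq₄)
      1+_ : ∀ {x y : ℤ} → x ≡ y → 1ℤ + x ≡ 1ℤ + y
      1+_ = cong (λ z → 1ℤ + z)
      four-divides : ∀ u → ∃ λ m → f u + g u ≡ ℤ.+ 4 * m
      four-divides u = by-cases (u ≟ᶠ 0#) ((u -ᶠ 1#) ≟ᶠ 0#)
        where
        by-cases : Dec (u ≈ 0#) → Dec (u -ᶠ 1# ≈ 0#) → ∃ λ m → f u + g u ≡ ℤ.+ 4 * m
        by-cases (yes u≈0) _ = 1ℤ , evaluate (1+ η-zero u≈0) (1+ trans (η-cong 1-u≈1) η1) (δ-yes u≈0) (δ-no u≉1)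
          where
          1-u≈1 = ≈-trans (+-congˡ (≈-trans (-‿cong u≈0) -0#≈0#)) (+-identityʳ 1#)
          u≉1 : ¬ u -ᶠ 1# ≈ 0#
          u≉1 u≈1 = 0≉1 (≈-trans (≈-sym u≈0) (x-y≈0⇒x≈y u 1# u≈1))
        by-cases (no u≉0) (yes u-1≈0) =
          1ℤ , evaluate (1+ trans (η-cong u≈1) η1) (1+ η-zero (x≈y⇒x-y≈0 (≈-sym u≈1))) (δ-no u≉0) (δ-yes u-1≈0)
          where u≈1 = x-y≈0⇒x≈y u 1# u-1≈0
        by-cases (no u≉0) (no u≉1)
          with η≉0 u u≉0 | η≉0 (1# -ᶠ u) (λ eq → u≉1 (x≈y⇒x-y≈0 (≈-sym (x-y≈0⇒x≈y 1# u eq))))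
        ... | m₁ , eq₁ | m₂ , eq₂ = m₁ * m₂ , trans (evaluate eq₁ eq₂ (δ-no u≉0) (δ-no u≉1)) (lem m₁ m₂)
          where
          lem : ∀ m₁ m₂ → ℤ.+ 2 * m₁ * (ℤ.+ 2 * m₂) + 0ℤ ≡ ℤ.+ 4 * (m₁ * m₂)
          lem = solve-∀
      total = sum-multiple (ℤ.+ 4) (four-divides ∘ to)

    ε≡-1 : q ℕ.% 4 ≡ 3 → ε ≡ -1ℤ
    ε≡-1 = proj₁ (sign-from-residue q ε≡±1 (proj₂ q-ε+4-multiple))

    ε≡1 : q ℕ.% 4 ≡ 1 → ε ≡ 1ℤ
    ε≡1 = proj₂ (sign-from-residue q ε≡±1 (proj₂ q-ε+4-multiple))

    -- Summation over the space, one coordinate at a time.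

    ∫ᵈ : ∀ d → (Point F d → ℤ) → ℤ
    ∫ᵈ zero    f = f []
    ∫ᵈ (suc d) f = ∫ λ a → ∫ᵈ d λ ξ → f (a ∷ ξ)

    ∫ᵈ-cong : ∀ d {f g : Point F d → ℤ} → (∀ ξ → f ξ ≡ g ξ) → ∫ᵈ d f ≡ ∫ᵈ d g
    ∫ᵈ-cong zero    eq = eq []
    ∫ᵈ-cong (suc d) eq = ∫-cong λ a → ∫ᵈ-cong d λ ξ → eq (a ∷ ξ)

    ∫ᵈ-+ : ∀ d (f g : Point F d → ℤ) → ∫ᵈ d (λ ξ → f ξ + g ξ) ≡ ∫ᵈ d f + ∫ᵈ d g
    ∫ᵈ-+ zero    f g = refl
    ∫ᵈ-+ (suc d) f g = trans (∫-cong λ a → ∫ᵈ-+ d (λ ξ → f (a ∷ ξ)) (λ ξ → g (a ∷ ξ)))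
      (∫-+ (λ a → ∫ᵈ d λ ξ → f (a ∷ ξ)) (λ a → ∫ᵈ d λ ξ → g (a ∷ ξ)))

    ∫ᵈ-* : ∀ d k (f : Point F d → ℤ) → ∫ᵈ d (λ ξ → k * f ξ) ≡ k * ∫ᵈ d f
    ∫ᵈ-* zero    k f = refl
    ∫ᵈ-* (suc d) k f = trans (∫-cong λ a → ∫ᵈ-* d k (λ ξ → f (a ∷ ξ))) (∫-* k (λ a → ∫ᵈ d λ ξ → f (a ∷ ξ)))

    ∫ᵈ-sum : ∀ d {n} (f : Fin n → Point F d → ℤ) → ∫ᵈ d (λ ξ → sum λ i → f i ξ) ≡ sum (λ i → ∫ᵈ d (f i))
    ∫ᵈ-sum zero    f = refl
    ∫ᵈ-sum (suc d) f = trans (∫-cong λ a → ∫ᵈ-sum d λ i ξ → f i (a ∷ ξ)) (∑-comm λ a i → ∫ᵈ d λ ξ → f i (to a ∷ ξ))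

    ∫ᵈ-mono : ∀ d {f g : Point F d → ℤ} → (∀ ξ → f ξ ≤ g ξ) → ∫ᵈ d f ≤ ∫ᵈ d g
    ∫ᵈ-mono zero    le = le []
    ∫ᵈ-mono (suc d) le = sum-mono λ a → ∫ᵈ-mono d λ ξ → le (to a ∷ ξ)

    ∫ᵈ-const : ∀ d k → ∫ᵈ d (λ _ → k) ≡ Q ℤ.^ d * k
    ∫ᵈ-const zero    k = sym (ℤₚ.*-identityˡ k)
    ∫ᵈ-const (suc d) k = trans (∫-cong λ _ → ∫ᵈ-const d k) (trans (∫-const _) (sym (ℤₚ.*-assoc Q _ k)))

    dot : ∀ {d} → Point F d → Point F d → Carrier
    dot x y = sumᶠ λ i → x i *ᶠ y i

    norm : ∀ {d} → Point F d → Carrier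
    norm x = dot x x

    ∫ᵈ-norm : ∀ d {φ} → Resp φ → ∀ c → ∫ᵈ d (λ ξ → φ (norm ξ +ᶠ c)) ≡ H^ d φ c
    ∫ᵈ-norm zero    φ-cong c = φ-cong (+-identityˡ c)
    ∫ᵈ-norm (suc d) φ-cong c = ∫-cong λ a → trans
      (∫ᵈ-cong d λ ξ → φ-cong (≈-trans (+-congʳ (+-comm (a *ᶠ a) (norm ξ))) (+-assoc _ _ c)))
      (∫ᵈ-norm d φ-cong (a *ᶠ a +ᶠ c))

    complete-square : ∀ a b n d c →
      a *ᶠ a +ᶠ n +ᶠ (a *ᶠ b +ᶠ d +ᶠ (a *ᶠ b +ᶠ d) +ᶠ c) ≈ n +ᶠ (d +ᶠ d +ᶠ ((a *ᶠ a +ᶠ (a *ᶠ b +ᶠ a *ᶠ b)) +ᶠ c))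
    complete-square a b n d c = solve 5 (λ a b n d c →
      a :* a :+ n :+ (a :* b :+ d :+ (a :* b :+ d) :+ c) := n :+ (d :+ d :+ ((a :* a :+ (a :* b :+ a :* b)) :+ c)))
      ≈-refl a b n d c

    complete-square′ : ∀ a b → a *ᶠ a +ᶠ (a *ᶠ b +ᶠ a *ᶠ b) ≈ (a +ᶠ b) *ᶠ (a +ᶠ b) -ᶠ b *ᶠ b
    complete-square′ a b = ≈-sym (begin
      (a +ᶠ b) *ᶠ (a +ᶠ b) -ᶠ b *ᶠ b
        ≈⟨ +-congʳ (solve 2 (λ a b → (a :+ b) :* (a :+ b) := a :* a :+ (a :* b :+ a :* b) :+ b :* b) ≈-refl a b) ⟩
      a *ᶠ a +ᶠ (a *ᶠ b +ᶠ a *ᶠ b) +ᶠ b *ᶠ b -ᶠ b *ᶠ b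
        ≈⟨ x+y-y≈x _ (b *ᶠ b) ⟩
      a *ᶠ a +ᶠ (a *ᶠ b +ᶠ a *ᶠ b) ∎)
      where open ≈-R

    -- Translating ξ by z completes the square: ‖ξ‖ + 2 ξ·z = ‖ξ + z‖ − ‖z‖.
    ∫ᵈ-translate : ∀ d {φ} → Resp φ → ∀ (z : Point F d) c →
      ∫ᵈ d (λ ξ → φ (norm ξ +ᶠ (dot ξ z +ᶠ dot ξ z +ᶠ c))) ≡ ∫ᵈ d (λ ξ → φ (norm ξ +ᶠ (-ᶠ norm z +ᶠ c)))
    ∫ᵈ-translate zero φ-cong z c = φ-cong (+-congˡ (+-congʳ
      (≈-trans (+-identityˡ 0#) (≈-sym -0#≈0#))))
    ∫ᵈ-translate (suc d) {φ} φ-cong z c = begin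
      ∫ (λ a → ∫ᵈ d λ ξ → φ (a *ᶠ a +ᶠ norm ξ +ᶠ (a *ᶠ b +ᶠ dot ξ z′ +ᶠ (a *ᶠ b +ᶠ dot ξ z′) +ᶠ c)))
        ≡⟨ ∫-cong (λ a → ∫ᵈ-cong d λ ξ → φ-cong (complete-square a b (norm ξ) (dot ξ z′) c)) ⟩
      ∫ (λ a → ∫ᵈ d λ ξ → φ (norm ξ +ᶠ (dot ξ z′ +ᶠ dot ξ z′ +ᶠ ((a *ᶠ a +ᶠ (a *ᶠ b +ᶠ a *ᶠ b)) +ᶠ c))))
        ≡⟨ ∫-cong (λ a → ∫ᵈ-translate d φ-cong z′ ((a *ᶠ a +ᶠ (a *ᶠ b +ᶠ a *ᶠ b)) +ᶠ c)) ⟩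
      ∫ (λ a → ∫ᵈ d λ ξ → φ (norm ξ +ᶠ (-ᶠ norm z′ +ᶠ ((a *ᶠ a +ᶠ (a *ᶠ b +ᶠ a *ᶠ b)) +ᶠ c))))
        ≡⟨ ∫-cong (λ a → ∫ᵈ-cong d λ ξ → φ-cong (+-congˡ (+-congˡ { -ᶠ norm z′} (+-congʳ (complete-square′ a b))))) ⟩
      ∫ (λ a → Ψ (a +ᶠ b))
        ≡⟨ ∫-shift b {Ψ} (λ eq → ∫ᵈ-cong d λ ξ → φ-cong (+-congˡ (+-congˡ { -ᶠ norm z′} (+-congʳ (+-congʳ (*-cong eq eq)))))) ⟩
      ∫ (λ a → ∫ᵈ d λ ξ → φ (norm ξ +ᶠ (-ᶠ norm z′ +ᶠ (a *ᶠ a -ᶠ b *ᶠ b +ᶠ c))))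
        ≡⟨ ∫-cong (λ a → ∫ᵈ-cong d λ ξ → φ-cong (rearrange a (norm ξ))) ⟩
      ∫ (λ a → ∫ᵈ d λ ξ → φ (a *ᶠ a +ᶠ norm ξ +ᶠ (-ᶠ (b *ᶠ b +ᶠ norm z′) +ᶠ c))) ∎
      where
      open ≡-Reasoning
      b = z zero
      z′ = z ∘ suc
      Ψ : Carrier → ℤ
      Ψ u = ∫ᵈ d λ ξ → φ (norm ξ +ᶠ (-ᶠ norm z′ +ᶠ (u *ᶠ u -ᶠ b *ᶠ b +ᶠ c)))
      rearrange : ∀ a n → n +ᶠ (-ᶠ norm z′ +ᶠ (a *ᶠ a -ᶠ b *ᶠ b +ᶠ c)) ≈ a *ᶠ a +ᶠ n +ᶠ (-ᶠ (b *ᶠ b +ᶠ norm z′) +ᶠ c)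
      rearrange a n = ≈-trans
        (solve 5 (λ a n m₁ m₂ c → n :+ (m₁ :+ (a :* a :+ m₂ :+ c)) := a :* a :+ n :+ (m₂ :+ m₁ :+ c)) ≈-refl
          a n (-ᶠ norm z′) (-ᶠ (b *ᶠ b)) c)
        (+-congˡ (+-congʳ (-‿+-comm (b *ᶠ b) (norm z′))))

    δᵈ : ∀ {d} → Point F d → ℤ
    δᵈ {zero}  ξ = 1ℤ
    δᵈ {suc d} ξ = δ (ξ zero) * δᵈ (ξ ∘ suc)

    -- A nonzero coordinate of z determines the matching coordinate of ξ from the others, whence
    -- q^(d-1) solutions. For z = 0 the equation no longer involves ξ; `δᵈ z` merges the two cases.
    orthogonal-count : ∀ d (z : Point F d) c →
      Q * ∫ᵈ d (λ ξ → δ (dot ξ z +ᶠ c)) ≡ Q ℤ.^ d * (1ℤ - δᵈ z) + Q * Q ℤ.^ d * (δᵈ z * δ c)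
    orthogonal-count zero z c = trans (cong (Q *_) (δ-cong (+-identityˡ c))) (lem Q (δ c))
      where
      lem : ∀ q d → q * d ≡ 1ℤ * (1ℤ - 1ℤ) + q * 1ℤ * (1ℤ * d)
      lem = solve-∀
    orthogonal-count (suc d) z c with z zero ≟ᶠ 0#
    ... | yes z₀≈0 = begin
      Q * ∫ (λ a → ∫ᵈ d λ ξ → δ (a *ᶠ z zero +ᶠ dot ξ (z ∘ suc) +ᶠ c))
        ≡⟨ cong (Q *_) (trans (∫-cong λ a → ∫ᵈ-cong d λ ξ → δ-cong
             (+-congʳ (≈-trans (+-congʳ (≈-trans (*-congˡ z₀≈0) (zeroʳ a))) (+-identityˡ _))))
           (∫-const (∫ᵈ d λ ξ → δ (dot ξ (z ∘ suc) +ᶠ c)))) ⟩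
      Q * (Q * ∫ᵈ d (λ ξ → δ (dot ξ (z ∘ suc) +ᶠ c)))
        ≡⟨ cong (Q *_) (orthogonal-count d (z ∘ suc) c) ⟩
      Q * (Q ℤ.^ d * (1ℤ - δᵈ (z ∘ suc)) + Q * Q ℤ.^ d * (δᵈ (z ∘ suc) * δ c))
        ≡⟨ lem Q (Q ℤ.^ d) (δᵈ (z ∘ suc)) (δ c) ⟩
      Q * Q ℤ.^ d * (1ℤ - 1ℤ * δᵈ (z ∘ suc)) + Q * (Q * Q ℤ.^ d) * (1ℤ * δᵈ (z ∘ suc) * δ c) ∎
      where
      open ≡-Reasoning
      lem : ∀ q p D d → q * (p * (1ℤ - D) + q * p * (D * d)) ≡ q * p * (1ℤ - 1ℤ * D) + q * (q * p) * (1ℤ * D * d)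
      lem = solve-∀
    ... | no z₀≉0 = begin
      Q * ∫ (λ a → ∫ᵈ d λ ξ → δ (a *ᶠ z zero +ᶠ dot ξ (z ∘ suc) +ᶠ c))
        ≡⟨ cong (Q *_) (∫ᵈ-sum d λ a ξ → δ (to a *ᶠ z zero +ᶠ dot ξ (z ∘ suc) +ᶠ c)) ⟨
      Q * ∫ᵈ d (λ ξ → ∫ λ a → δ (a *ᶠ z zero +ᶠ dot ξ (z ∘ suc) +ᶠ c))
        ≡⟨ cong (Q *_) (∫ᵈ-cong d λ ξ → trans
             (∫-cong λ a → δ-cong (≈-trans (+-assoc _ _ c) (+-congʳ (*-comm a (z zero)))))
             (trans (∫-affine z₀≉0 (dot ξ (z ∘ suc) +ᶠ c) {δ} δ-cong) ∫δ)) ⟩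
      Q * ∫ᵈ d (λ ξ → 1ℤ)
        ≡⟨ cong (Q *_) (∫ᵈ-const d 1ℤ) ⟩
      Q * (Q ℤ.^ d * 1ℤ)
        ≡⟨ lem Q (Q ℤ.^ d) (δᵈ (z ∘ suc)) (δ c) ⟩
      Q * Q ℤ.^ d * (1ℤ - 0ℤ * δᵈ (z ∘ suc)) + Q * (Q * Q ℤ.^ d) * (0ℤ * δᵈ (z ∘ suc) * δ c) ∎
      where
      open ≡-Reasoning
      lem : ∀ q p D d → q * (p * 1ℤ) ≡ q * p * (1ℤ - 0ℤ * D) + q * (q * p) * (0ℤ * D * d)
      lem = solve-∀

    -- Since ‖s z‖ = s² ‖z‖, this makes all multiples s z with s ≠ 0 contribute equally.
    SquareInvariant : (Carrier → ℤ) → Set _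
    SquareInvariant φ = ∀ {u} → ¬ u ≈ 0# → ∀ t → φ (u *ᶠ u *ᶠ t) ≡ φ t

    -- The substitution s ↦ u s takes u² out of s² + u² c.
    H-square-invariant : ∀ {φ} → Resp φ → SquareInvariant φ → SquareInvariant (H φ)
    H-square-invariant {φ} φ-cong inv {u} u≉0 c = begin
      ∫ (λ s → φ (s *ᶠ s +ᶠ u *ᶠ u *ᶠ c))
        ≡⟨ ∫-scale u≉0 {λ s → φ (s *ᶠ s +ᶠ u *ᶠ u *ᶠ c)} (λ eq → φ-cong (+-congʳ (*-cong eq eq))) ⟨
      ∫ (λ s → φ (u *ᶠ s *ᶠ (u *ᶠ s) +ᶠ u *ᶠ u *ᶠ c))
        ≡⟨ ∫-cong (λ s → φ-cong (solve 3 (λ u s c → u :* s :* (u :* s) :+ u :* u :* c := u :* u :* (s :* s :+ c)) ≈-refl u s c)) ⟩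
      ∫ (λ s → φ (u *ᶠ u *ᶠ (s *ᶠ s +ᶠ c)))
        ≡⟨ ∫-cong (λ s → inv u≉0 (s *ᶠ s +ᶠ c)) ⟩
      ∫ (λ s → φ (s *ᶠ s +ᶠ c)) ∎
      where open ≡-Reasoning

    H^-square-invariant : ∀ k {φ} → Resp φ → SquareInvariant φ → SquareInvariant (H^ k φ)
    H^-square-invariant zero    φ-cong inv = inv
    H^-square-invariant (suc k) φ-cong inv = H-square-invariant (H^-cong k φ-cong) (H^-square-invariant k φ-cong inv)

    ∫-constant-off-0 : ∀ {φ k} → Resp φ → (∀ s → ¬ s ≈ 0# → φ s ≡ k) → ∫ φ ≡ φ 0# + (Q - 1ℤ) * k
    ∫-constant-off-0 {φ} {k} φ-cong const = begin
      ∫ φ                                     ≡⟨ ∫-cong split ⟩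
      ∫ (λ s → k + (φ 0# - k) * δ s)          ≡⟨ ∫-+ (λ _ → k) (λ s → (φ 0# - k) * δ s) ⟩
      ∫ (λ _ → k) + ∫ (λ s → (φ 0# - k) * δ s) ≡⟨ cong₂ _+_ (∫-const k) (trans (∫-* (φ 0# - k) δ) (cong ((φ 0# - k) *_) ∫δ)) ⟩
      Q * k + (φ 0# - k) * 1ℤ                 ≡⟨ lem Q k (φ 0#) ⟩
      φ 0# + (Q - 1ℤ) * k                     ∎
      where
      open ≡-Reasoning
      lem : ∀ q k f → q * k + (f - k) * 1ℤ ≡ f + (q - 1ℤ) * k
      lem = solve-∀
      lem₀ : ∀ k f → f ≡ k + (f - k) * 1ℤ
      lem₀ = solve-∀
      lem₁ : ∀ k f → k ≡ k + (f - k) * 0ℤ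
      lem₁ = solve-∀
      split : ∀ s → φ s ≡ k + (φ 0# - k) * δ s
      split s with s ≟ᶠ 0#
      ... | yes s≈0 = trans (φ-cong s≈0) (lem₀ k (φ 0#))
      ... | no s≉0  = trans (const s s≉0) (lem₁ k (φ 0#))

    ∫-select₀ : ∀ {φ} → Resp φ → ∫ (λ s → δ s * φ s) ≡ φ 0#
    ∫-select₀ {φ} φ-cong = trans
      (∫-cong λ s → cong (_* φ s) (δ-cong (≈-sym (≈-trans (+-congˡ -0#≈0#) (+-identityʳ s)))))
      (∫-select 0# φ-cong)

    -- For b ≠ 0 the map s ↦ n + 2 b s is a bijection, since 2 ≠ 0; for b = 0 it is constant.
    ∫-line : ∀ {φ} → Resp φ → ∀ n b → ∫ (λ s → φ (n +ᶠ (s *ᶠ b +ᶠ s *ᶠ b))) ≡ Q * (δ b * φ n) + (1ℤ - δ b) * ∫ φ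
    ∫-line {φ} φ-cong n b with b ≟ᶠ 0#
    ... | yes b≈0 = trans (∫-cong λ s → φ-cong (≈-trans (+-congˡ (x≈0⇒x+x≈0 (≈-trans (*-congˡ b≈0) (zeroʳ s)))) (+-identityʳ n)))
          (trans (∫-const (φ n)) (lem Q (φ n) (∫ φ)))
      where
      lem : ∀ q f w → q * f ≡ q * (1ℤ * f) + (1ℤ - 1ℤ) * w
      lem = solve-∀
    ... | no b≉0 = trans
          (∫-cong λ s → φ-cong (solve 3 (λ n s b → n :+ (s :* b :+ s :* b) := (b :+ b) :* s :+ n) ≈-refl n s b))
          (trans (∫-affine (b≉0 ∘ x+x≈0⇒x≈0) n φ-cong) (lem Q (φ n) (∫ φ)))
      where
      lem : ∀ q f w → w ≡ q * (0ℤ * f) + (1ℤ - 0ℤ) * w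
      lem = solve-∀

    dot-scaleʳ : ∀ {d} s (ξ z : Point F d) → dot ξ (λ k → s *ᶠ z k) ≈ s *ᶠ dot ξ z
    dot-scaleʳ {zero}  s ξ z = ≈-sym (zeroʳ s)
    dot-scaleʳ {suc d} s ξ z = ≈-trans
      (+-cong (solve 3 (λ x s z → x :* (s :* z) := s :* (x :* z)) ≈-refl (ξ zero) s (z zero)) (dot-scaleʳ s (ξ ∘ suc) (z ∘ suc)))
      (≈-sym (distribˡ s _ _))

    norm-scale : ∀ {d} s (z : Point F d) → norm (λ k → s *ᶠ z k) ≈ s *ᶠ s *ᶠ norm z
    norm-scale {zero}  s z = ≈-sym (zeroʳ (s *ᶠ s))
    norm-scale {suc d} s z = ≈-trans
      (+-cong (solve 2 (λ s z → s :* z :* (s :* z) := s :* s :* (z :* z)) ≈-refl s (z zero)) (norm-scale s (z ∘ suc)))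
      (≈-sym (distribˡ (s *ᶠ s) _ _))

    dot-subʳ : ∀ {d} (ξ x y : Point F d) → dot ξ (λ k → x k -ᶠ y k) ≈ dot ξ x -ᶠ dot ξ y
    dot-subʳ {zero}  ξ x y = ≈-sym (-‿inverseʳ 0#)
    dot-subʳ {suc d} ξ x y = begin
      ξ₀ *ᶠ (x₀ -ᶠ y₀) +ᶠ dot (ξ ∘ suc) (λ k → x (suc k) -ᶠ y (suc k))
        ≈⟨ +-cong (x[y-z]≈xy-xz ξ₀ x₀ y₀) (dot-subʳ (ξ ∘ suc) (x ∘ suc) (y ∘ suc)) ⟩
      ξ₀ *ᶠ x₀ -ᶠ ξ₀ *ᶠ y₀ +ᶠ (X -ᶠ Y)
        ≈⟨ solve 4 (λ a b c d → a :+ b :+ (c :+ d) := a :+ c :+ (b :+ d)) ≈-refl (ξ₀ *ᶠ x₀) (-ᶠ (ξ₀ *ᶠ y₀)) X (-ᶠ Y) ⟩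
      ξ₀ *ᶠ x₀ +ᶠ X +ᶠ (-ᶠ (ξ₀ *ᶠ y₀) -ᶠ Y)
        ≈⟨ +-congˡ (-‿+-comm (ξ₀ *ᶠ y₀) Y) ⟩
      ξ₀ *ᶠ x₀ +ᶠ X -ᶠ (ξ₀ *ᶠ y₀ +ᶠ Y) ∎
      where
      open ≈-R
      ξ₀ = ξ zero
      x₀ = x zero
      y₀ = y zero
      X = dot (ξ ∘ suc) (x ∘ suc)
      Y = dot (ξ ∘ suc) (y ∘ suc)

    dot-zeroˡ : ∀ {d} (ξ z : Point F d) → (∀ k → ξ k ≈ 0#) → dot ξ z ≈ 0#
    dot-zeroˡ {zero}  ξ z ξ≈0 = ≈-refl
    dot-zeroˡ {suc d} ξ z ξ≈0 = ≈-trans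
      (+-cong (≈-trans (*-congʳ (ξ≈0 zero)) (zeroˡ _)) (dot-zeroˡ (ξ ∘ suc) (z ∘ suc) (ξ≈0 ∘ suc))) (+-identityˡ 0#)

    δᵈ-yes : ∀ {d} {ξ : Point F d} → (∀ k → ξ k ≈ 0#) → δᵈ ξ ≡ 1ℤ
    δᵈ-yes {zero}  ξ≈0 = refl
    δᵈ-yes {suc d} ξ≈0 = cong₂ _*_ (δ-yes (ξ≈0 zero)) (δᵈ-yes (ξ≈0 ∘ suc))

    δᵈ-cases : ∀ {d} (ξ : Point F d) → (∀ k → ξ k ≈ 0#) ⊎ δᵈ ξ ≡ 0ℤ
    δᵈ-cases {zero}  ξ = inj₁ λ ()
    δᵈ-cases {suc d} ξ with ξ zero ≟ᶠ 0# | δᵈ-cases (ξ ∘ suc)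
    ... | no _    | _       = inj₂ (ℤₚ.*-zeroˡ (δᵈ (ξ ∘ suc)))
    ... | yes _   | inj₂ eq = inj₂ (trans (ℤₚ.*-identityˡ _) eq)
    ... | yes eq  | inj₁ eqs = inj₁ λ { zero → eq ; (suc k) → eqs k }

    ∫ᵈ-select₀ : ∀ d {φ} → Resp φ → ∀ c → ∫ᵈ d (λ ξ → δᵈ ξ * φ (norm ξ +ᶠ c)) ≡ φ c
    ∫ᵈ-select₀ zero {φ} φ-cong c = trans (ℤₚ.*-identityˡ (φ (0# +ᶠ c))) (φ-cong (+-identityˡ c))
    ∫ᵈ-select₀ (suc d) {φ} φ-cong c = begin
      ∫ (λ a → ∫ᵈ d λ ξ → δ a * δᵈ ξ * φ (a *ᶠ a +ᶠ norm ξ +ᶠ c))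
        ≡⟨ ∫-cong (λ a → trans
             (∫ᵈ-cong d λ ξ → trans (ℤₚ.*-assoc (δ a) (δᵈ ξ) _)
               (cong (λ z → δ a * (δᵈ ξ * z)) (φ-cong (≈-trans (+-congʳ (+-comm (a *ᶠ a) (norm ξ))) (+-assoc _ _ c)))))
             (∫ᵈ-* d (δ a) (λ ξ → δᵈ ξ * φ (norm ξ +ᶠ (a *ᶠ a +ᶠ c))))) ⟩
      ∫ (λ a → δ a * ∫ᵈ d (λ ξ → δᵈ ξ * φ (norm ξ +ᶠ (a *ᶠ a +ᶠ c))))
        ≡⟨ ∫-cong (λ a → cong (δ a *_) (∫ᵈ-select₀ d φ-cong (a *ᶠ a +ᶠ c))) ⟩
      ∫ (λ a → δ a * φ (a *ᶠ a +ᶠ c))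
        ≡⟨ ∫-select₀ {λ a → φ (a *ᶠ a +ᶠ c)} (λ eq → φ-cong (+-congʳ (*-cong eq eq))) ⟩
      φ (0# *ᶠ 0# +ᶠ c)
        ≡⟨ φ-cong (≈-trans (+-congʳ (zeroˡ 0#)) (+-identityˡ c)) ⟩
      φ c ∎
      where open ≡-Reasoning

    -- Weighted sums over hyperplanes.

    module _ {d : ℕ} {w : Carrier → ℤ} (w-cong : Resp w) (w-inv : SquareInvariant w) where

      perp : Point F d → ℤ
      perp z = ∫ᵈ d λ ξ → δ (dot ξ z) * w (norm ξ)

      -- Double count of w(‖ξ‖ + 2 s ξ·z): for fixed s a translation evaluates the sum over ξ, for
      -- fixed ξ `∫-line` evaluates the sum over s.
      perp-scaled : ∀ z → ∫ (λ s → H^ d w (-ᶠ (s *ᶠ s *ᶠ norm z))) ≡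
        Q * perp z + (Q ℤ.^ d - ∫ᵈ d (λ ξ → δ (dot ξ z))) * ∫ w
      perp-scaled z = begin
        ∫ (λ s → H^ d w (-ᶠ (s *ᶠ s *ᶠ norm z)))
          ≡⟨ ∫-cong (λ s → ∫ᵈ-norm d w-cong (-ᶠ (s *ᶠ s *ᶠ norm z))) ⟨
        ∫ (λ s → ∫ᵈ d λ ξ → w (norm ξ -ᶠ s *ᶠ s *ᶠ norm z))
          ≡⟨ ∫-cong (λ s → ∫ᵈ-cong d λ ξ → w-cong (+-congˡ (≈-trans (-‿cong (≈-sym (norm-scale s z))) (≈-sym (+-identityʳ _))))) ⟩
        ∫ (λ s → ∫ᵈ d λ ξ → w (norm ξ +ᶠ (-ᶠ norm (λ k → s *ᶠ z k) +ᶠ 0#)))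
          ≡⟨ ∫-cong (λ s → ∫ᵈ-translate d w-cong (λ k → s *ᶠ z k) 0#) ⟨
        ∫ (λ s → ∫ᵈ d λ ξ → w (norm ξ +ᶠ (dot ξ (λ k → s *ᶠ z k) +ᶠ dot ξ (λ k → s *ᶠ z k) +ᶠ 0#)))
          ≡⟨ ∫-cong (λ s → ∫ᵈ-cong d λ ξ → w-cong (+-congˡ (≈-trans (+-identityʳ _) (+-cong (dot-scaleʳ s ξ z) (dot-scaleʳ s ξ z))))) ⟩
        ∫ (λ s → ∫ᵈ d λ ξ → w (norm ξ +ᶠ (s *ᶠ dot ξ z +ᶠ s *ᶠ dot ξ z)))
          ≡⟨ ∫ᵈ-sum d (λ s ξ → w (norm ξ +ᶠ (to s *ᶠ dot ξ z +ᶠ to s *ᶠ dot ξ z))) ⟨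
        ∫ᵈ d (λ ξ → ∫ λ s → w (norm ξ +ᶠ (s *ᶠ dot ξ z +ᶠ s *ᶠ dot ξ z)))
          ≡⟨ ∫ᵈ-cong d (λ ξ → trans (∫-line w-cong (norm ξ) (dot ξ z)) (lem₁ Q (δ (dot ξ z)) (w (norm ξ)) (∫ w))) ⟩
        ∫ᵈ d (λ ξ → Q * (δ (dot ξ z) * w (norm ξ)) + (∫ w + - ∫ w * δ (dot ξ z)))
          ≡⟨ trans (∫ᵈ-+ d (λ ξ → Q * (δ (dot ξ z) * w (norm ξ))) (λ ξ → ∫ w + - ∫ w * δ (dot ξ z)))
               (cong₂ _+_ (∫ᵈ-* d Q (λ ξ → δ (dot ξ z) * w (norm ξ)))
                 (trans (∫ᵈ-+ d (λ _ → ∫ w) (λ ξ → - ∫ w * δ (dot ξ z)))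
                   (cong₂ _+_ (∫ᵈ-const d (∫ w)) (∫ᵈ-* d (- ∫ w) (λ ξ → δ (dot ξ z)))))) ⟩
        Q * perp z + (Q ℤ.^ d * ∫ w + - ∫ w * ∫ᵈ d (λ ξ → δ (dot ξ z)))
          ≡⟨ lem₂ (Q * perp z) (Q ℤ.^ d) (∫ w) (∫ᵈ d (λ ξ → δ (dot ξ z))) ⟩
        Q * perp z + (Q ℤ.^ d - ∫ᵈ d (λ ξ → δ (dot ξ z))) * ∫ w ∎
        where
        open ≡-Reasoning
        lem₁ : ∀ q e f w → q * (e * f) + (1ℤ - e) * w ≡ q * (e * f) + (w + - w * e)
        lem₁ = solve-∀
        lem₂ : ∀ p r w c → p + (r * w + - w * c) ≡ p + (r - c) * w
        lem₂ = solve-∀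

      G : Point F d → ℤ
      G z = H^ d w (-ᶠ norm z)

      -- In `perp-scaled` the term s = 0 is `H^ d w 0#`, and each of the Q - 1 others is `G z` by
      -- square invariance. The second factor Q keeps the hyperplane count integral, and `δᵈ z`
      -- accounts for z = 0, to which every ξ is orthogonal.
      perp-formula : ∀ z → Q * (Q * perp z) ≡
        Q * H^ d w 0# + (Q - 1ℤ) * (Q * G z) + Q ℤ.^ d * (Q - 1ℤ) * ∫ w * (δᵈ z - 1ℤ)
      perp-formula z = begin
        Q * (Q * perp z)
          ≡⟨ lem₁ Q (perp z) (Q ℤ.^ d) C (∫ w) ⟩
        Q * (Q * perp z + (Q ℤ.^ d - C) * ∫ w) + (Q * C - Q * Q ℤ.^ d) * ∫ w
          ≡⟨ cong₂ (λ x y → Q * x + (y - Q * Q ℤ.^ d) * ∫ w) (trans (sym (perp-scaled z)) total) count ⟩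
        Q * (H^ d w 0# + (Q - 1ℤ) * G z) + (Q ℤ.^ d * (1ℤ - δᵈ z) + Q * Q ℤ.^ d * (δᵈ z * 1ℤ) - Q * Q ℤ.^ d) * ∫ w
          ≡⟨ lem₂ Q (H^ d w 0#) (G z) (Q ℤ.^ d) (δᵈ z) (∫ w) ⟩
        Q * H^ d w 0# + (Q - 1ℤ) * (Q * G z) + Q ℤ.^ d * (Q - 1ℤ) * ∫ w * (δᵈ z - 1ℤ) ∎
        where
        open ≡-Reasoning
        C = ∫ᵈ d (λ ξ → δ (dot ξ z))
        lem₁ : ∀ q p r c w → q * (q * p) ≡ q * (q * p + (r - c) * w) + (q * c - q * r) * w
        lem₁ = solve-∀
        lem₂ : ∀ q h g r e w → q * (h + (q - 1ℤ) * g) + (r * (1ℤ - e) + q * r * (e * 1ℤ) - q * r) * w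
          ≡ q * h + (q - 1ℤ) * (q * g) + r * (q - 1ℤ) * w * (e - 1ℤ)
        lem₂ = solve-∀
        count : Q * C ≡ Q ℤ.^ d * (1ℤ - δᵈ z) + Q * Q ℤ.^ d * (δᵈ z * 1ℤ)
        count = trans (cong (Q *_) (∫ᵈ-cong d λ ξ → δ-cong (≈-sym (+-identityʳ (dot ξ z)))))
          (trans (orthogonal-count d z 0#) (cong (λ e → Q ℤ.^ d * (1ℤ - δᵈ z) + Q * Q ℤ.^ d * (δᵈ z * e)) (δ-yes ≈-refl)))
        total : ∫ (λ s → H^ d w (-ᶠ (s *ᶠ s *ᶠ norm z))) ≡ H^ d w 0# + (Q - 1ℤ) * G z
        total = trans
          (∫-constant-off-0 {λ s → H^ d w (-ᶠ (s *ᶠ s *ᶠ norm z))}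
            (λ eq → H^-cong d w-cong (-‿cong (*-congʳ (*-cong eq eq))))
            (λ s s≉0 → trans (H^-cong d w-cong (-‿distribʳ-* (s *ᶠ s) (norm z)))
                         (H^-square-invariant d w-cong w-inv s≉0 (-ᶠ norm z))))
          (cong (_+ (Q - 1ℤ) * G z) (H^-cong d w-cong
            (≈-trans (-‿cong (≈-trans (*-congʳ (zeroˡ 0#)) (zeroˡ _))) -0#≈0#)))

    -- The weighted Cauchy-Schwarz inequality for pairs of points.

    0≤i*i : ∀ i → 0ℤ ≤ i * i
    0≤i*i i = ℤₚ.≤-trans (+≤+ ℕ.z≤n) (ℤₚ.≤-reflexive (trans (ℤₚ.pos-* ℤ.∣ i ∣ ℤ.∣ i ∣) (abs² i)))
      where
      abs² : ∀ i → ℤ.+ ℤ.∣ i ∣ * ℤ.+ ℤ.∣ i ∣ ≡ i * i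
      abs² (ℤ.+ n)    = refl
      abs² ℤ.-[1+ n ] = refl

    0<Q : ℤ.Positive Q
    0<Q = positive q (from 0#)
      where
      positive : ∀ q → Fin q → ℤ.Positive (ℤ.+ q)
      positive (suc q) _ = _

    -- 0 ≤ Σ_c (q N(c) − n)², where N(c) counts the i with v i = c.
    collisions-bound : ∀ {n} (v : Fin n → Carrier) → ℤ.+ n * ℤ.+ n ≤ Q * ∑∑ (λ i j → δ (v i -ᶠ v j))
    collisions-bound {n} v = ℤₚ.*-cancelˡ-≤-pos _ _ Q {{0<Q}} (ℤₚ.0≤i-j⇒j≤i (begin
      0ℤ                                                     ≤⟨ 0≤square ⟩
      ∫ (λ c → (Q * N c - M) * (Q * N c - M))                ≡⟨ ∫-cong (λ c → lem₁ Q (N c) M) ⟩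
      ∫ (λ c → Q * Q * (N c * N c) + (- (Q * M + Q * M) * N c + M * M))
        ≡⟨ trans (∫-+ (λ c → Q * Q * (N c * N c)) (λ c → - (Q * M + Q * M) * N c + M * M))
             (cong₂ _+_ (∫-* (Q * Q) (λ c → N c * N c))
               (trans (∫-+ (λ c → - (Q * M + Q * M) * N c) (λ _ → M * M)) (cong₂ _+_ (∫-* (- (Q * M + Q * M)) N) (∫-const (M * M))))) ⟩
      Q * Q * ∫ (λ c → N c * N c) + (- (Q * M + Q * M) * ∫ N + Q * (M * M))
        ≡⟨ cong₂ (λ x y → Q * Q * x + (- (Q * M + Q * M) * y + Q * (M * M))) ∫N² ∫N ⟩
      Q * Q * S + (- (Q * M + Q * M) * M + Q * (M * M))      ≡⟨ lem₂ Q M S ⟩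
      Q * (Q * S) - Q * (M * M)                              ∎))
      where
      open ℤₚ.≤-Reasoning
      M = ℤ.+ n
      N : Carrier → ℤ
      N c = sum λ i → δ (c -ᶠ v i)
      S = ∑∑ (λ i j → δ (v i -ᶠ v j))
      lem₁ : ∀ q n m → (q * n - m) * (q * n - m) ≡ q * q * (n * n) + (- (q * m + q * m) * n + m * m)
      lem₁ = solve-∀
      lem₂ : ∀ q m s → q * q * s + (- (q * m + q * m) * m + q * (m * m)) ≡ q * (q * s) - q * (m * m)
      lem₂ = solve-∀
      0≤square : 0ℤ ≤ ∫ (λ c → (Q * N c - M) * (Q * N c - M))
      0≤square = ℤₚ.≤-trans (ℤₚ.≤-reflexive (sym (trans (∫-const 0ℤ) (ℤₚ.*-zeroʳ Q)))) (sum-mono λ c → 0≤i*i (Q * N (to c) - M))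
      ∫N : ∫ N ≡ M
      ∫N = trans (∑-comm λ c i → δ (to c -ᶠ v i)) (trans (sum-cong-≗ λ i → trans (∫-shift (-ᶠ v i) {δ} δ-cong) ∫δ)
             (trans (sum-const n 1ℤ) (ℤₚ.*-identityʳ M)))
      ∫N² : ∫ (λ c → N c * N c) ≡ S
      ∫N² = trans (∫-cong λ c → sum-*-sum (λ i → δ (c -ᶠ v i)) (λ j → δ (c -ᶠ v j)))
        (trans (∑-comm λ c i → sum λ j → δ (to c -ᶠ v i) * δ (to c -ᶠ v j))
        (sum-cong-≗ λ i → trans (∑-comm λ c j → δ (to c -ᶠ v i) * δ (to c -ᶠ v j))
          (sum-cong-≗ λ j → ∫-select (v i) {λ c → δ (c -ᶠ v j)} λ eq → δ-cong (+-congʳ eq))))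

    1<q : 1 ℕ.< q
    1<q = at-least-two q (from 0#) (from 1#) λ eq → 0≉1
      (≈-trans (≈-sym (strictlyInverseˡ 0#)) (≈-trans (to-cong eq) (strictlyInverseˡ 1#)))
      where
      at-least-two : ∀ q (i j : Fin q) → i ≢ j → 1 ℕ.< q
      at-least-two (suc zero)    zero zero i≢j = contradiction refl i≢j
      at-least-two (suc (suc q)) _    _    _   = ℕ.s≤s (ℕ.s≤s ℕ.z≤n)

    0<Q-1 : ℤ.Positive (Q - 1ℤ)
    0<Q-1 = positive 1<q
      where
      positive : ∀ {q} → 1 ℕ.< q → ℤ.Positive (ℤ.+ q - 1ℤ)
      positive (ℕ.s≤s (ℕ.s≤s _)) = _

    _-ᵖ_ : ∀ {d} → Point F d → Point F d → Point F d
    (x -ᵖ y) k = x k -ᶠ y k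

    module _ {d n : ℕ} {w : Carrier → ℤ} (w-cong : Resp w) (w-inv : SquareInvariant w) (0≤w : ∀ t → 0ℤ ≤ w t)
      (x : Fin n → Point F d) (distinct : ∀ i j → (∀ k → x i k ≈ x j k) → i ≡ j) where

      private
        N = ℤ.+ n

      -- Distinctness of the points enters here: off the diagonal no difference vanishes.
      ∑∑δᵈ : ∑∑ (λ i j → δᵈ (x i -ᵖ x j)) ≡ N
      ∑∑δᵈ = trans (sum-cong-≗ λ i → trans (sum-cong-≗ (diagonal i)) (sum-𝟙 i))
        (trans (sum-const n 1ℤ) (ℤₚ.*-identityʳ N))
        where
        diagonal : ∀ i j → δᵈ (x i -ᵖ x j) ≡ 𝟙 (j Finₚ.≟ i)
        diagonal i j with j Finₚ.≟ i
        ... | yes refl = δᵈ-yes λ k → -‿inverseʳ (x i k)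
        ... | no  j≢i with δᵈ-cases (x i -ᵖ x j)
        ...   | inj₁ eqs = contradiction (sym (distinct i j λ k → x-y≈0⇒x≈y (x i k) (x j k) (eqs k))) j≢i
        ...   | inj₂ eq  = eq

      -- Exchanges the sums: ξ ⊥ x_i - x_j means that ξ·x_i and ξ·x_j collide.
      ∑∑perp : ∑∑ (λ i j → perp w-cong w-inv (x i -ᵖ x j)) ≡
        ∫ᵈ d (λ ξ → w (norm ξ) * ∑∑ (λ i j → δ (dot ξ (x i) -ᶠ dot ξ (x j))))
      ∑∑perp = sym (trans
        (∫ᵈ-cong d λ ξ → trans (sym (∑∑-* (w (norm ξ)) (λ i j → δ (dot ξ (x i) -ᶠ dot ξ (x j))))) (∑∑-cong λ i j → trans (ℤₚ.*-comm (w (norm ξ)) (δ (dot ξ (x i) -ᶠ dot ξ (x j))))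
          (cong (_* w (norm ξ)) (δ-cong (≈-sym (dot-subʳ ξ (x i) (x j)))))))
        (trans (∫ᵈ-sum d (λ i ξ → sum λ j → δ (dot ξ (x i -ᵖ x j)) * w (norm ξ)))
          (sum-cong-≗ λ i → ∫ᵈ-sum d (λ j ξ → δ (dot ξ (x i -ᵖ x j)) * w (norm ξ)))))

      -- At ξ = 0 every pair collides, so there the general bound is improved by the factor q.
      collisions : ∀ ξ → N * N + (Q - 1ℤ) * (N * N) * δᵈ ξ ≤ Q * ∑∑ (λ i j → δ (dot ξ (x i) -ᶠ dot ξ (x j)))
      collisions ξ with δᵈ-cases ξ
      ... | inj₂ eq = ℤₚ.≤-trans
            (ℤₚ.≤-reflexive (trans (cong (λ e → N * N + (Q - 1ℤ) * (N * N) * e) eq) (lem (N * N) ((Q - 1ℤ) * (N * N)))))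
            (collisions-bound (dot ξ ∘ x))
        where
        lem : ∀ m k → m + k * 0ℤ ≡ m
        lem = solve-∀
      ... | inj₁ ξ≈0 = ℤₚ.≤-reflexive (trans (cong (λ e → N * N + (Q - 1ℤ) * (N * N) * e) (δᵈ-yes ξ≈0)) (trans (lem N Q)
            (cong (Q *_) (sym (trans (∑∑-cong collide) (∑∑-const n 1ℤ))))))
        where
        collide : ∀ i j → δ (dot ξ (x i) -ᶠ dot ξ (x j)) ≡ 1ℤ
        collide i j = δ-yes (x≈y⇒x-y≈0 (≈-trans (dot-zeroˡ ξ (x i) ξ≈0) (≈-sym (dot-zeroˡ ξ (x j) ξ≈0))))
        lem : ∀ m q → m * m + (q - 1ℤ) * (m * m) * 1ℤ ≡ q * (m * (m * 1ℤ))
        lem = solve-∀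

      -- Sums `collisions` over ξ with weight w(‖ξ‖), whose nonnegativity preserves the direction.
      -- The improvement at ξ = 0 becomes the term with `w 0#`.
      collisions-total : N * N * H^ d w 0# + (Q - 1ℤ) * (N * N) * w 0# ≤ Q * ∑∑ (λ i j → perp w-cong w-inv (x i -ᵖ x j))
      collisions-total = begin
        N * N * H^ d w 0# + (Q - 1ℤ) * (N * N) * w 0#
          ≡⟨ cong₂ _+_ (trans (∫ᵈ-* d (N * N) (λ ξ → w (norm ξ +ᶠ 0#))) (cong (N * N *_) (∫ᵈ-norm d w-cong 0#)))
               (trans (∫ᵈ-* d ((Q - 1ℤ) * (N * N)) (λ ξ → δᵈ ξ * w (norm ξ +ᶠ 0#)))
                 (cong ((Q - 1ℤ) * (N * N) *_) (∫ᵈ-select₀ d w-cong 0#))) ⟨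
        ∫ᵈ d (λ ξ → N * N * w (norm ξ +ᶠ 0#)) + ∫ᵈ d (λ ξ → (Q - 1ℤ) * (N * N) * (δᵈ ξ * w (norm ξ +ᶠ 0#)))
          ≡⟨ ∫ᵈ-+ d (λ ξ → N * N * w (norm ξ +ᶠ 0#)) (λ ξ → (Q - 1ℤ) * (N * N) * (δᵈ ξ * w (norm ξ +ᶠ 0#))) ⟨
        ∫ᵈ d (λ ξ → N * N * w (norm ξ +ᶠ 0#) + (Q - 1ℤ) * (N * N) * (δᵈ ξ * w (norm ξ +ᶠ 0#)))
          ≡⟨ ∫ᵈ-cong d (λ ξ → trans (lem₁ (N * N) (w (norm ξ +ᶠ 0#)) ((Q - 1ℤ) * (N * N)) (δᵈ ξ))
               (cong (_* (N * N + (Q - 1ℤ) * (N * N) * δᵈ ξ)) (w-cong (+-identityʳ (norm ξ))))) ⟩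
        ∫ᵈ d (λ ξ → w (norm ξ) * (N * N + (Q - 1ℤ) * (N * N) * δᵈ ξ))
          ≤⟨ ∫ᵈ-mono d (λ ξ → ℤₚ.*-monoˡ-≤-nonNeg (w (norm ξ)) {{ℤ.nonNegative (0≤w (norm ξ))}} (collisions ξ)) ⟩
        ∫ᵈ d (λ ξ → w (norm ξ) * (Q * K ξ))
          ≡⟨ trans (∫ᵈ-cong d λ ξ → lem₂ (w (norm ξ)) Q (K ξ)) (∫ᵈ-* d Q (λ ξ → w (norm ξ) * K ξ)) ⟩
        Q * ∫ᵈ d (λ ξ → w (norm ξ) * K ξ)
          ≡⟨ cong (Q *_) ∑∑perp ⟨
        Q * ∑∑ (λ i j → perp w-cong w-inv (x i -ᵖ x j)) ∎
        where
        open ℤₚ.≤-Reasoning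
        K : Point F d → ℤ
        K ξ = ∑∑ (λ i j → δ (dot ξ (x i) -ᶠ dot ξ (x j)))
        lem₁ : ∀ m f k e → m * f + k * (e * f) ≡ f * (m + k * e)
        lem₁ = solve-∀
        lem₂ : ∀ f q k → f * (q * k) ≡ q * (f * k)
        lem₂ = solve-∀

      -- Inserting `perp-formula` into `collisions-total` makes the terms with `H^ d w 0#` cancel,
      -- and the rest has the positive factor Q - 1. What remains of the weight is its value at 0,
      -- its total, and one sum per pair.
      weighted-bound : Q * (N * N) * w 0# + Q ℤ.^ d * (N * N - N) * ∫ w ≤
        ∑∑ (λ i j → Q * H^ d w (-ᶠ dist F (x i) (x j)))
      weighted-bound = ℤₚ.*-cancelˡ-≤-pos _ _ (Q - 1ℤ) {{0<Q-1}} (ℤₚ.0≤i-j⇒j≤i (begin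
        0ℤ
          ≤⟨ ℤₚ.i≤j⇒0≤j-i (ℤₚ.*-monoˡ-≤-nonNeg Q collisions-total) ⟩
        Q * (Q * ∑∑ P) - Q * (N * N * g₀ + (Q - 1ℤ) * (N * N) * w 0#)
          ≡⟨ cong (_- Q * (N * N * g₀ + (Q - 1ℤ) * (N * N) * w 0#)) total ⟩
        N * (N * (Q * g₀)) + ((Q - 1ℤ) * ∑∑ QG + Q ℤ.^ d * (Q - 1ℤ) * ∫ w * (N - N * (N * 1ℤ)))
          - Q * (N * N * g₀ + (Q - 1ℤ) * (N * N) * w 0#)
          ≡⟨ lem N Q g₀ (∑∑ QG) (Q ℤ.^ d) (∫ w) (w 0#) ⟩
        (Q - 1ℤ) * ∑∑ QG - (Q - 1ℤ) * (Q * (N * N) * w 0# + Q ℤ.^ d * (N * N - N) * ∫ w) ∎))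
        where
        open ℤₚ.≤-Reasoning
        g₀ = H^ d w 0#
        P QG D : Fin n → Fin n → ℤ
        P i j = perp w-cong w-inv (x i -ᵖ x j)
        QG i j = Q * H^ d w (-ᶠ dist F (x i) (x j))
        D i j = δᵈ (x i -ᵖ x j)
        k = Q ℤ.^ d * (Q - 1ℤ) * ∫ w
        lem : ∀ N Q g S p W v → N * (N * (Q * g)) + ((Q - 1ℤ) * S + p * (Q - 1ℤ) * W * (N - N * (N * 1ℤ)))
          - Q * (N * N * g + (Q - 1ℤ) * (N * N) * v) ≡ (Q - 1ℤ) * S - (Q - 1ℤ) * (Q * (N * N) * v + p * (N * N - N) * W)
        lem = solve-∀
        lem₁ : ∀ a b c k e → a + b + c * (e - k) ≡ a + (b + c * (e - k))
        lem₁ = solve-∀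
        total : Q * (Q * ∑∑ P) ≡ N * (N * (Q * g₀)) + ((Q - 1ℤ) * ∑∑ QG + k * (N - N * (N * 1ℤ)))
        total = begin-equality
          Q * (Q * ∑∑ P)
            ≡⟨ trans (∑∑-* Q (λ i j → Q * P i j)) (cong (Q *_) (∑∑-* Q P)) ⟨
          ∑∑ (λ i j → Q * (Q * P i j))
            ≡⟨ ∑∑-cong (λ i j → trans (perp-formula w-cong w-inv (x i -ᵖ x j)) (lem₁ (Q * g₀) ((Q - 1ℤ) * QG i j) k 1ℤ (D i j))) ⟩
          ∑∑ (λ i j → Q * g₀ + ((Q - 1ℤ) * QG i j + k * (D i j - 1ℤ)))
            ≡⟨ trans (∑∑-+ (λ _ _ → Q * g₀) (λ i j → (Q - 1ℤ) * QG i j + k * (D i j - 1ℤ))) (cong₂ _+_ (∑∑-const n (Q * g₀))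
                 (trans (∑∑-+ (λ i j → (Q - 1ℤ) * QG i j) (λ i j → k * (D i j - 1ℤ))) (cong₂ _+_ (∑∑-* (Q - 1ℤ) QG)
                   (trans (∑∑-* k (λ i j → D i j - 1ℤ)) (cong (k *_) (∑∑-+ D (λ _ _ → -1ℤ))))))) ⟩
          N * (N * (Q * g₀)) + ((Q - 1ℤ) * ∑∑ QG + k * (∑∑ D + ∑∑ {n} (λ _ _ → -1ℤ)))
            ≡⟨ cong₂ (λ e f → N * (N * (Q * g₀)) + ((Q - 1ℤ) * ∑∑ QG + k * (e + f))) ∑∑δᵈ (trans (∑∑-const n -1ℤ) (lem₂ N)) ⟩
          N * (N * (Q * g₀)) + ((Q - 1ℤ) * ∑∑ QG + k * (N - N * (N * 1ℤ))) ∎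
          where
          lem₂ : ∀ N → N * (N * -1ℤ) ≡ - (N * (N * 1ℤ))
          lem₂ = solve-∀

    -- The function K and the two weights built from it.

    κ : Carrier → ℤ
    κ a = η F a + δ a

    κ-cong : Resp κ
    κ-cong eq = cong₂ _+_ (η-cong eq) (δ-cong eq)

    -- Twice the indicator of a counted pair, minus 1, phrased with the decisions by which `SQ` and
    -- `ZR` filter.
    counts : ℤ → ℤ
    counts e = ℤ.+ 2 * (𝟙 (e ℤₚ.≟ 1ℤ) + 𝟙 (e ℤₚ.≟ 0ℤ)) - 1ℤ

    κ≡counts-η : ∀ a → κ a ≡ counts (η F a)
    κ≡counts-η a with classify a
    ... | vanishing a≈0     = trans (cong₂ _+_ (η-zero a≈0) (δ-yes a≈0)) (cong counts (sym (η-zero a≈0)))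
    ... | square a≉0 sq     = trans (cong₂ _+_ (η-square a≉0 sq) (δ-no a≉0)) (cong counts (sym (η-square a≉0 sq)))
    ... | nonsquare a≉0 ¬sq = trans (cong₂ _+_ (η-nonsquare a≉0 ¬sq) (δ-no a≉0)) (cong counts (sym (η-nonsquare a≉0 ¬sq)))

    κ≡±1 : ∀ a → κ a ≡ 1ℤ ⊎ κ a ≡ -1ℤ
    κ≡±1 a with classify a
    ... | vanishing a≈0     = inj₁ (cong₂ _+_ (η-zero a≈0) (δ-yes a≈0))
    ... | square a≉0 sq     = inj₁ (cong₂ _+_ (η-square a≉0 sq) (δ-no a≉0))
    ... | nonsquare a≉0 ¬sq = inj₂ (cong₂ _+_ (η-nonsquare a≉0 ¬sq) (δ-no a≉0))

    ∫κ : ∫ κ ≡ 1ℤ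
    ∫κ = trans (∫-+ (η F) δ) (cong₂ _+_ ∫η ∫δ)

    δ-square-invariant : SquareInvariant δ
    δ-square-invariant u≉0 t = δ-⇔ (xy≈0⇒y≈0 (u≉0 ∘ x²≈0⇒x≈0)) (λ t≈0 → ≈-trans (*-congˡ t≈0) (zeroʳ _))

    κ-square-invariant : SquareInvariant κ
    κ-square-invariant u≉0 t = cong₂ _+_ (η-square-* u≉0 t) (δ-square-invariant u≉0 t)

    data Sign : ℤ → Set where
      plus  : Sign 1ℤ
      minus : Sign -1ℤ

    -- Up to scaling λ − K̂ as a function of ‖ξ‖, where K̂(ξ) is the Fourier transform of κ ∘ ‖·‖ and λ its
    -- largest value for ξ ≠ 0; σ is the sign ε^⌊d/2⌋, and α is q for σ = 1 and 1 for σ = −1.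
    evenWeight : ℤ → Carrier → ℤ
    evenWeight σ t = 1ℤ - σ * κ (-ᶠ t)

    oddWeight : ℤ → ℤ → Carrier → ℤ
    oddWeight α σ t = α - σ * (η F t + Q * δ t)

    evenWeight-cong : ∀ σ → Resp (evenWeight σ)
    evenWeight-cong σ eq = cong (λ z → 1ℤ - σ * z) (κ-cong (-‿cong eq))

    evenWeight-inv : ∀ σ → SquareInvariant (evenWeight σ)
    evenWeight-inv σ u≉0 t = cong (λ z → 1ℤ - σ * z)
      (trans (κ-cong (-‿distribʳ-* _ t)) (κ-square-invariant u≉0 (-ᶠ t)))

    -- Both σ and κ are ±1, so the only values are 0 and 2; matching on the sign lets the comparison
    -- compute.
    0≤evenWeight : ∀ {σ} → Sign σ → ∀ t → 0ℤ ≤ evenWeight σ t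
    0≤evenWeight {σ} s t with κ≡±1 (-ᶠ t)
    0≤evenWeight plus  t | inj₁ eq = subst (λ z → 0ℤ ≤ 1ℤ - 1ℤ * z) (sym eq) (+≤+ ℕ.z≤n)
    0≤evenWeight minus t | inj₁ eq = subst (λ z → 0ℤ ≤ 1ℤ - -1ℤ * z) (sym eq) (+≤+ ℕ.z≤n)
    0≤evenWeight plus  t | inj₂ eq = subst (λ z → 0ℤ ≤ 1ℤ - 1ℤ * z) (sym eq) (+≤+ ℕ.z≤n)
    0≤evenWeight minus t | inj₂ eq = subst (λ z → 0ℤ ≤ 1ℤ - -1ℤ * z) (sym eq) (+≤+ ℕ.z≤n)

    evenWeight-0 : ∀ σ → evenWeight σ 0# ≡ 1ℤ - σ * 1ℤ
    evenWeight-0 σ = cong (λ z → 1ℤ - σ * z) (cong₂ _+_ (η-zero -0#≈0#) (δ-yes -0#≈0#))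

    evenWeight-neg : ∀ σ a → evenWeight σ (-ᶠ a) ≡ 1ℤ - σ * κ a
    evenWeight-neg σ a = cong (λ z → 1ℤ - σ * z) (κ-cong (-ᶠ-involutive a))

    ∫-minus : ∀ k σ φ → ∫ (λ t → k - σ * φ t) ≡ Q * k - σ * ∫ φ
    ∫-minus k σ φ = trans (∫-cong λ t → cong (λ z → k + z) (ℤₚ.neg-distribˡ-* σ (φ t)))
      (trans (∫-+ (λ _ → k) (λ t → - σ * φ t))
        (cong₂ _+_ (∫-const k) (trans (∫-* (- σ) φ) (sym (ℤₚ.neg-distribˡ-* σ (∫ φ))))))

    ∫-evenWeight : ∀ σ → ∫ (evenWeight σ) ≡ Q * 1ℤ - σ * 1ℤ
    ∫-evenWeight σ = trans (∫-minus 1ℤ σ (λ t → κ (-ᶠ t)))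
      (cong (λ z → Q * 1ℤ - σ * z) (trans (∫-neg {κ} κ-cong) ∫κ))

    oddWeight-cong : ∀ α σ → Resp (oddWeight α σ)
    oddWeight-cong α σ eq = cong (λ z → α - σ * z) (cong₂ _+_ (η-cong eq) (cong (Q *_) (δ-cong eq)))

    oddWeight-inv : ∀ α σ → SquareInvariant (oddWeight α σ)
    oddWeight-inv α σ u≉0 t = cong (λ z → α - σ * z)
      (cong₂ _+_ (η-square-* u≉0 t) (cong (Q *_) (δ-square-invariant u≉0 t)))

    oddWeight-0 : ∀ α σ → oddWeight α σ 0# ≡ α - σ * (0ℤ + Q * 1ℤ)
    oddWeight-0 α σ = cong (λ z → α - σ * z) (cong₂ _+_ (η-zero ≈-refl) (cong (Q *_) (δ-yes ≈-refl)))

    ∫-η+Qδ : ∫ (λ t → η F t + Q * δ t) ≡ Q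
    ∫-η+Qδ = trans (∫-+ (η F) (λ t → Q * δ t))
      (trans (cong₂ _+_ ∫η (trans (∫-* Q δ) (cong (Q *_) ∫δ))) (trans (ℤₚ.+-identityˡ _) (ℤₚ.*-identityʳ Q)))

    ∫-oddWeight : ∀ α σ → ∫ (oddWeight α σ) ≡ Q * α - σ * Q
    ∫-oddWeight α σ = trans (∫-minus α σ (λ t → η F t + Q * δ t)) (cong (λ z → Q * α - σ * z) ∫-η+Qδ)

    -- The leftover coordinate exchanges the two summands of the weight: summing η yields Q δ and
    -- summing Q δ yields Q (1 + η), each up to lower terms, so κ reappears.
    H-oddWeight : ∀ α σ a → H (oddWeight α σ) (-ᶠ a) ≡ Q * α - σ * (Q - 1ℤ + Q * κ a)
    H-oddWeight α σ a = trans (∫-minus α σ (λ s → η F (s *ᶠ s -ᶠ a) + Q * δ (s *ᶠ s -ᶠ a)))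
      (cong (λ z → Q * α - σ * z) (begin
        ∫ (λ s → η F (s *ᶠ s -ᶠ a) + Q * δ (s *ᶠ s -ᶠ a))
          ≡⟨ ∫-+ (λ s → η F (s *ᶠ s -ᶠ a)) (λ s → Q * δ (s *ᶠ s -ᶠ a)) ⟩
        ∫ (λ s → η F (s *ᶠ s -ᶠ a)) + ∫ (λ s → Q * δ (s *ᶠ s -ᶠ a))
          ≡⟨ cong₂ _+_ (trans (∫η-square+ (-ᶠ a)) (cong (λ z → Q * z - 1ℤ) (δ-neg a)))
               (trans (∫-* Q (λ s → δ (s *ᶠ s -ᶠ a))) (cong (Q *_) (∫-roots a))) ⟩
        Q * δ a - 1ℤ + Q * (1ℤ + η F a)
          ≡⟨ lem Q (δ a) (η F a) ⟩
        Q - 1ℤ + Q * κ a ∎))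
      where
      open ≡-Reasoning
      lem : ∀ q d e → q * d - 1ℤ + q * (1ℤ + e) ≡ q - 1ℤ + q * (e + d)
      lem = solve-∀

    -- The constant must dominate η + Q δ, which is Q at 0 and ±1 elsewhere. Hence α = Q, with
    -- equality at 0.
    0≤oddWeight⁺ : ∀ t → 0ℤ ≤ oddWeight Q 1ℤ t
    0≤oddWeight⁺ t with classify t
    ... | vanishing t≈0     = subst₂ (λ e z → 0ℤ ≤ Q - 1ℤ * (e + Q * z)) (sym (η-zero t≈0)) (sym (δ-yes t≈0)) (ℤₚ.≤-reflexive (lem Q))
      where
      lem : ∀ q → 0ℤ ≡ q - 1ℤ * (0ℤ + q * 1ℤ)
      lem = solve-∀
    ... | square t≉0 sq     = subst₂ (λ e z → 0ℤ ≤ Q - 1ℤ * (e + Q * z)) (sym (η-square t≉0 sq)) (sym (δ-no t≉0))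
        (ℤₚ.≤-trans (ℤₚ.i≤j⇒0≤j-i (+≤+ (ℕₚ.<⇒≤ 1<q))) (ℤₚ.≤-reflexive (lem Q)))
      where
      lem : ∀ q → q - 1ℤ ≡ q - 1ℤ * (1ℤ + q * 0ℤ)
      lem = solve-∀
    ... | nonsquare t≉0 ¬sq = subst₂ (λ e z → 0ℤ ≤ Q - 1ℤ * (e + Q * z)) (sym (η-nonsquare t≉0 ¬sq)) (sym (δ-no t≉0))
        (ℤₚ.≤-trans (+≤+ ℕ.z≤n) (ℤₚ.≤-reflexive (lem Q)))
      where
      lem : ∀ q → q + 1ℤ ≡ q - 1ℤ * (-1ℤ + q * 0ℤ)
      lem = solve-∀

    -- Here the constant must dominate -(η + Q δ), which is -Q at 0 and ±1 elsewhere. Hence α = 1,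
    -- with equality at nonsquares.
    0≤oddWeight⁻ : ∀ t → 0ℤ ≤ oddWeight 1ℤ -1ℤ t
    0≤oddWeight⁻ t with classify t
    ... | vanishing t≈0     = subst₂ (λ e z → 0ℤ ≤ 1ℤ - -1ℤ * (e + Q * z)) (sym (η-zero t≈0)) (sym (δ-yes t≈0))
        (ℤₚ.≤-trans (+≤+ ℕ.z≤n) (ℤₚ.≤-reflexive (lem Q)))
      where
      lem : ∀ q → 1ℤ + q ≡ 1ℤ - -1ℤ * (0ℤ + q * 1ℤ)
      lem = solve-∀
    ... | square t≉0 sq     = subst₂ (λ e z → 0ℤ ≤ 1ℤ - -1ℤ * (e + Q * z)) (sym (η-square t≉0 sq)) (sym (δ-no t≉0))
        (ℤₚ.≤-trans (+≤+ ℕ.z≤n) (ℤₚ.≤-reflexive (lem Q)))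
      where
      lem : ∀ q → ℤ.+ 2 ≡ 1ℤ - -1ℤ * (1ℤ + q * 0ℤ)
      lem = solve-∀
    ... | nonsquare t≉0 ¬sq = subst₂ (λ e z → 0ℤ ≤ 1ℤ - -1ℤ * (e + Q * z)) (sym (η-nonsquare t≉0 ¬sq)) (sym (δ-no t≉0))
        (ℤₚ.≤-reflexive (lem Q))
      where
      lem : ∀ q → 0ℤ ≡ 1ℤ - -1ℤ * (-1ℤ + q * 0ℤ)
      lem = solve-∀

    -- The sign ε^k.

    ε²≡1 : ε * ε ≡ 1ℤ
    ε²≡1 with ε≡±1
    ... | inj₁ eq = cong₂ _*_ eq eq
    ... | inj₂ eq = cong₂ _*_ eq eq

    -- The factor 1 is kept so that all signs occur in the uniform shape `σ * Q ℤ.^ k`.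
    εQ^-even : ∀ j → (ε * Q) ℤ.^ (j ℕ.* 2) ≡ 1ℤ * Q ℤ.^ (j ℕ.* 2)
    εQ^-even zero    = refl
    εQ^-even (suc j) = begin
      ε * Q * (ε * Q * (ε * Q) ℤ.^ (j ℕ.* 2))   ≡⟨ cong (λ z → ε * Q * (ε * Q * z)) (εQ^-even j) ⟩
      ε * Q * (ε * Q * (1ℤ * Q ℤ.^ (j ℕ.* 2)))   ≡⟨ lem ε Q (Q ℤ.^ (j ℕ.* 2)) ⟩
      ε * ε * (Q * (Q * Q ℤ.^ (j ℕ.* 2)))       ≡⟨ cong (_* (Q * (Q * Q ℤ.^ (j ℕ.* 2)))) ε²≡1 ⟩
      1ℤ * (Q * (Q * Q ℤ.^ (j ℕ.* 2)))          ∎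
      where
      open ≡-Reasoning
      lem : ∀ e q p → e * q * (e * q * (1ℤ * p)) ≡ e * e * (q * (q * p))
      lem = solve-∀

    εQ^-odd : ∀ j → (ε * Q) ℤ.^ suc (j ℕ.* 2) ≡ ε * Q ℤ.^ suc (j ℕ.* 2)
    εQ^-odd j = trans (cong (ε * Q *_) (εQ^-even j)) (lem ε Q (Q ℤ.^ (j ℕ.* 2)))
      where
      lem : ∀ e q p → e * q * (1ℤ * p) ≡ e * (q * p)
      lem = solve-∀

    εQ^-odd-sign : ∀ j {σ} → ε ≡ σ → (ε * Q) ℤ.^ suc (j ℕ.* 2) ≡ σ * Q ℤ.^ suc (j ℕ.* 2)
    εQ^-odd-sign j refl = εQ^-odd j

    ^-double : ∀ i k b → i ℤ.^ (k ℕ.* 2 ℕ.+ b) ≡ i ℤ.^ k * i ℤ.^ k * i ℤ.^ b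
    ^-double i zero    b = sym (ℤₚ.*-identityˡ (i ℤ.^ b))
    ^-double i (suc k) b = trans (cong (λ z → i * (i * z)) (^-double i k b)) (lem i (i ℤ.^ k) (i ℤ.^ b))
      where
      lem : ∀ i p r → i * (i * (p * p * r)) ≡ i * p * (i * p) * r
      lem = solve-∀

    -- Stated through differences so that a single ring identity transforms one inequality into the other.
    ≤-from-difference : ∀ {p l r l′ r′} → ℤ.Positive p → l′ ≤ r′ → r′ - l′ ≡ p * (r - l) → l ≤ r
    ≤-from-difference {p} {l} {r} {l′} {r′} p>0 l′≤r′ eq = ℤₚ.0≤i-j⇒j≤i
      (ℤₚ.*-cancelˡ-≤-pos 0ℤ (r - l) p {{p>0}} (begin
        p * 0ℤ         ≡⟨ ℤₚ.*-zeroʳ p ⟩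
        0ℤ             ≤⟨ ℤₚ.i≤j⇒0≤j-i l′≤r′ ⟩
        r′ - l′        ≡⟨ eq ⟩
        p * (r - l)    ∎))
      where open ℤₚ.≤-Reasoning

    -- From weighted sums to the four bounds.

    module _ {d : ℕ} (A : List (Point F d)) (A! : Distinct F A) where
      private
        n = length A
        N = ℤ.+ n
        M = ℤ.+ (SQ F A ℕ.+ ZR F A)
        two = ℤ.+ 2
        x : Fin n → Point F d
        x = lookup A
        d² : Fin n → Fin n → Carrier
        d² i j = dist F (x i) (x j)

      -- The place where the count enters: a counted pair contributes 1, any other -1.
      ∑∑κ : ∑∑ (λ i j → κ (d² i j)) ≡ two * M - N * N
      ∑∑κ = begin
        ∑∑ (λ i j → κ (d² i j))
          ≡⟨ ∑∑-cong (λ i j → κ≡counts-η (d² i j)) ⟩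
        ∑∑ (λ i j → two * (s i j + z i j) + -1ℤ)
          ≡⟨ trans (∑∑-+ (λ i j → two * (s i j + z i j)) (λ _ _ → -1ℤ)) (cong₂ _+_
               (trans (∑∑-* two (λ i j → s i j + z i j)) (cong (two *_) (∑∑-+ s z))) (∑∑-const n -1ℤ)) ⟩
        two * (∑∑ s + ∑∑ z) + N * (N * -1ℤ)
          ≡⟨ cong₂ (λ e f → two * (e + f) + N * (N * -1ℤ))
               (length-filter-cartesianProduct (λ (x , y) → η F (dist F x y) ℤₚ.≟ 1ℤ) A A)
               (length-filter-cartesianProduct (λ (x , y) → η F (dist F x y) ℤₚ.≟ 0ℤ) A A) ⟨
        two * M + N * (N * -1ℤ)
          ≡⟨ lem M N ⟩
        two * M - N * N ∎
        where
        open ≡-Reasoning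
        s z : Fin n → Fin n → ℤ
        s i j = 𝟙 (η F (d² i j) ℤₚ.≟ 1ℤ)
        z i j = 𝟙 (η F (d² i j) ℤₚ.≟ 0ℤ)
        lem : ∀ m n → ℤ.+ 2 * m + n * (n * -1ℤ) ≡ ℤ.+ 2 * m - n * n
        lem = solve-∀

      ∑∑-affine : ∀ a b → ∑∑ (λ i j → a + b * κ (d² i j)) ≡ N * (N * a) + b * (two * M - N * N)
      ∑∑-affine a b = trans (∑∑-+ (λ _ _ → a) (λ i j → b * κ (d² i j)))
        (cong₂ _+_ (∑∑-const n a) (trans (∑∑-* b (λ i j → κ (d² i j))) (cong (b *_) ∑∑κ)))

      private
        distinct : ∀ i j → (∀ k → x i k ≈ x j k) → i ≡ j
        distinct = lookup-injective (VecEq.≋-setoid ≈-setoid d) A!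

      -- With no coordinate left over, `H^-closed` returns the weight itself at -‖x-y‖, which is 1 -
      -- σ κ; hence the affine dependence on κ. Both sides stay unsimplified because a ring identity
      -- consumes them later.
      even-bound : ∀ k {σ} → d ≡ k ℕ.* 2 ℕ.+ 0 → Sign σ → (ε * Q) ℤ.^ k ≡ σ * Q ℤ.^ k → let P = Q ℤ.^ k; W = Q * 1ℤ - σ * 1ℤ in
        Q * (N * N) * (1ℤ - σ * 1ℤ) + P * P * 1ℤ * (N * N - N) * W ≤
        N * (N * (σ * P * (Q * 1ℤ) + (P * P * 1ℤ - σ * P * 1ℤ) * W)) + - (σ * P * Q * σ) * (two * M - N * N)
      even-bound k {σ} refl sgn E≡ = begin
        Q * (N * N) * (1ℤ - σ * 1ℤ) + P * P * 1ℤ * (N * N - N) * W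
          ≡⟨ cong₂ _+_ (cong (Q * (N * N) *_) (evenWeight-0 σ))
               (cong₂ (λ p v → p * (N * N - N) * v) (^-double Q k 0) (∫-evenWeight σ)) ⟨
        Q * (N * N) * w 0# + Q ℤ.^ d * (N * N - N) * ∫ w
          ≤⟨ weighted-bound (evenWeight-cong σ) (evenWeight-inv σ) (0≤evenWeight sgn) x distinct ⟩
        ∑∑ (λ i j → Q * H^ d w (-ᶠ d² i j))
          ≡⟨ ∑∑-cong (λ i j → trans (H^-closed 0 k (evenWeight-cong σ) (-ᶠ d² i j)) (evaluate (d² i j))) ⟩
        ∑∑ (λ i j → σ * P * (Q * 1ℤ) + (P * P * 1ℤ - σ * P * 1ℤ) * W + - (σ * P * Q * σ) * κ (d² i j))
          ≡⟨ ∑∑-affine _ (- (σ * P * Q * σ)) ⟩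
        N * (N * (σ * P * (Q * 1ℤ) + (P * P * 1ℤ - σ * P * 1ℤ) * W)) + - (σ * P * Q * σ) * (two * M - N * N) ∎
        where
        open ℤₚ.≤-Reasoning
        P = Q ℤ.^ k
        W = Q * 1ℤ - σ * 1ℤ
        w = evenWeight σ
        lem : ∀ σ P Q W κ → σ * P * (Q * (1ℤ - σ * κ)) + (P * P * 1ℤ - σ * P * 1ℤ) * W
          ≡ σ * P * (Q * 1ℤ) + (P * P * 1ℤ - σ * P * 1ℤ) * W + - (σ * P * Q * σ) * κ
        lem = solve-∀
        evaluate : ∀ a → (ε * Q) ℤ.^ k * (Q * w (-ᶠ a)) + (Q ℤ.^ d - (ε * Q) ℤ.^ k * 1ℤ) * ∫ w
          ≡ σ * P * (Q * 1ℤ) + (P * P * 1ℤ - σ * P * 1ℤ) * W + - (σ * P * Q * σ) * κ a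
        evaluate a = trans
          (cong₂ (λ e v → e * (Q * v) + (Q ℤ.^ d - e * 1ℤ) * ∫ w) E≡ (evenWeight-neg σ a))
          (trans (cong₂ (λ p v → σ * P * (Q * (1ℤ - σ * κ a)) + (p - σ * P * 1ℤ) * v) (^-double Q k 0) (∫-evenWeight σ))
            (lem σ P Q W (κ a)))

      -- One coordinate is left over, and `H-oddWeight` supplies the affine dependence on κ.
      odd-bound : ∀ k {α σ} → d ≡ k ℕ.* 2 ℕ.+ 1 → (∀ t → 0ℤ ≤ oddWeight α σ t) → (ε * Q) ℤ.^ k ≡ σ * Q ℤ.^ k →
        let P = Q ℤ.^ k; W = Q * α - σ * Q; Q¹ = Q * 1ℤ in
        Q * (N * N) * (α - σ * (0ℤ + Q * 1ℤ)) + P * P * Q¹ * (N * N - N) * W ≤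
        N * (N * (σ * P * (Q * (Q * α - σ * (Q - 1ℤ))) + (P * P * Q¹ - σ * P * Q¹) * W)) + - (σ * P * Q * σ * Q) * (two * M - N * N)
      odd-bound k {α} {σ} refl 0≤w E≡ = begin
        Q * (N * N) * (α - σ * (0ℤ + Q * 1ℤ)) + P * P * Q¹ * (N * N - N) * W
          ≡⟨ cong₂ _+_ (cong (Q * (N * N) *_) (oddWeight-0 α σ))
               (cong₂ (λ p v → p * (N * N - N) * v) (^-double Q k 1) (∫-oddWeight α σ)) ⟨
        Q * (N * N) * w 0# + Q ℤ.^ d * (N * N - N) * ∫ w
          ≤⟨ weighted-bound (oddWeight-cong α σ) (oddWeight-inv α σ) 0≤w x distinct ⟩
        ∑∑ (λ i j → Q * H^ d w (-ᶠ d² i j))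
          ≡⟨ ∑∑-cong (λ i j → trans (H^-closed 1 k (oddWeight-cong α σ) (-ᶠ d² i j)) (evaluate (d² i j))) ⟩
        ∑∑ (λ i j → σ * P * (Q * (Q * α - σ * (Q - 1ℤ))) + (P * P * Q¹ - σ * P * Q¹) * W + - (σ * P * Q * σ * Q) * κ (d² i j))
          ≡⟨ ∑∑-affine _ (- (σ * P * Q * σ * Q)) ⟩
        N * (N * (σ * P * (Q * (Q * α - σ * (Q - 1ℤ))) + (P * P * Q¹ - σ * P * Q¹) * W)) + - (σ * P * Q * σ * Q) * (two * M - N * N) ∎
        where
        open ℤₚ.≤-Reasoning
        P = Q ℤ.^ k
        W = Q * α - σ * Q
        Q¹ = Q * 1ℤ
        w = oddWeight α σ
        lem : ∀ α σ P Q W κ → σ * P * (Q * (Q * α - σ * (Q - 1ℤ + Q * κ))) + (P * P * (Q * 1ℤ) - σ * P * (Q * 1ℤ)) * W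
          ≡ σ * P * (Q * (Q * α - σ * (Q - 1ℤ))) + (P * P * (Q * 1ℤ) - σ * P * (Q * 1ℤ)) * W + - (σ * P * Q * σ * Q) * κ
        lem = solve-∀
        evaluate : ∀ a → (ε * Q) ℤ.^ k * (Q * H w (-ᶠ a)) + (Q ℤ.^ d - (ε * Q) ℤ.^ k * Q¹) * ∫ w
          ≡ σ * P * (Q * (Q * α - σ * (Q - 1ℤ))) + (P * P * Q¹ - σ * P * Q¹) * W + - (σ * P * Q * σ * Q) * κ a
        evaluate a = trans
          (cong₂ (λ e v → e * (Q * v) + (Q ℤ.^ d - e * Q¹) * ∫ w) E≡ (H-oddWeight α σ a))
          (trans (cong₂ (λ p v → σ * P * (Q * (Q * α - σ * (Q - 1ℤ + Q * κ a))) + (p - σ * P * Q¹) * v) (^-double Q k 1) (∫-oddWeight α σ))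
            (lem α σ P Q W (κ a)))

    module _ .{{_ : ℕ.NonZero q}} {d : ℕ} (A : List (Point F d)) (A! : Distinct F A) where
      private
        n = length A
        m = SQ F A ℕ.+ ZR F A
        count = m ÷ 1

      -- The weight is 1 + Q at 0, which produces the two subtracted terms in n². A factor Q is all
      -- that the two sides share.
      odd-minus : ∀ k → d ≡ k ℕ.* 2 ℕ.+ 1 → (ε * Q) ℤ.^ k ≡ -1ℤ * Q ℤ.^ k →
        count ℚ.≤ n ℕ.^ 2 ÷ 2 ⊕ ½ ⊛ (n ℕ.^ 2 ÷ q)
                ⊖ ½ ⊛ (n ℕ.^ 2 ÷⟨ q ^ ((d ℕ.∸ 1) ℕ./ 2) ⟩)
                ⊖ ½ ⊛ (n ℕ.^ 2 ÷⟨ q ^ ((d ℕ.+ 1) ℕ./ 2) ⟩)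
                ⊕ (q ℕ.^ ((d ℕ.∸ 1) ℕ./ 2) ℕ.* n) ÷ 1
      odd-minus k d≡ E≡ = clear-odd n q m k (half-pred k d≡) (half-suc k d≡)
        (≤-from-difference 0<Q (odd-bound A A! k {1ℤ} { -1ℤ} d≡ 0≤oddWeight⁻ E≡) (lem (ℤ.+ n) Q (Q ℤ.^ k) (ℤ.+ m)))
        where
        lem : ∀ N Q P M →
          N * (N * (-1ℤ * P * (Q * (Q * 1ℤ - -1ℤ * (Q - 1ℤ))) + (P * P * (Q * 1ℤ) - -1ℤ * P * (Q * 1ℤ)) * (Q * 1ℤ - -1ℤ * Q)))
            + - (-1ℤ * P * Q * -1ℤ * Q) * (ℤ.+ 2 * M - N * N)
            - (Q * (N * N) * (1ℤ - -1ℤ * (0ℤ + Q * 1ℤ)) + P * P * (Q * 1ℤ) * (N * N - N) * (Q * 1ℤ - -1ℤ * Q))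
          ≡ Q * (N * N * (Q * P) + 1ℤ * (N * N) * P - 1ℤ * (N * N) * Q - 1ℤ * (N * N) + P * N * (ℤ.+ 2 * (Q * P))
            - M * (ℤ.+ 2 * (Q * P)))
        lem = solve-∀

      -- The weight vanishes at 0, so no negative n² term appears and the whole of P Q cancels.
      odd-plus : ∀ k → d ≡ k ℕ.* 2 ℕ.+ 1 → (ε * Q) ℤ.^ k ≡ 1ℤ * Q ℤ.^ k →
        count ℚ.≤ n ℕ.^ 2 ÷ 2 ⊕ ½ ⊛ (n ℕ.^ 2 ÷ q)
                ⊕ (q ℕ.^ ((d ℕ.+ 1) ℕ./ 2) ℕ.* n) ÷ 2
                ⊖ (q ℕ.^ ((d ℕ.∸ 1) ℕ./ 2) ℕ.* n) ÷ 2
      odd-plus k d≡ E≡ = clear-difference n q m k (half-suc k d≡) (half-pred k d≡)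
        (≤-from-difference (*-positive (^-positive k 0<Q) 0<Q) (odd-bound A A! k {Q} {1ℤ} d≡ 0≤oddWeight⁺ E≡)
          (lem (ℤ.+ n) Q (Q ℤ.^ k) (ℤ.+ m)))
        where
        lem : ∀ N Q P M →
          N * (N * (1ℤ * P * (Q * (Q * Q - 1ℤ * (Q - 1ℤ))) + (P * P * (Q * 1ℤ) - 1ℤ * P * (Q * 1ℤ)) * (Q * Q - 1ℤ * Q)))
            + - (1ℤ * P * Q * 1ℤ * Q) * (ℤ.+ 2 * M - N * N)
            - (Q * (N * N) * (Q - 1ℤ * (0ℤ + Q * 1ℤ)) + P * P * (Q * 1ℤ) * (N * N - N) * (Q * Q - 1ℤ * Q))
          ≡ P * Q * (N * N * Q + 1ℤ * (N * N) + Q * P * N * Q - P * N * Q - M * (ℤ.+ 2 * Q))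
        lem = solve-∀

      -- The value 2 of the weight at 0 produces the subtracted n² / q^(d/2).
      even-minus : ∀ k → d ≡ suc k ℕ.* 2 ℕ.+ 0 → (ε * Q) ℤ.^ suc k ≡ -1ℤ * Q ℤ.^ suc k →
        count ℚ.≤ n ℕ.^ 2 ÷ 2 ⊕ ½ ⊛ (n ℕ.^ 2 ÷ q)
                ⊖ n ℕ.^ 2 ÷⟨ q ^ (d ℕ./ 2) ⟩
                ⊕ (q ℕ.^ (d ℕ./ 2) ℕ.* n) ÷ 2
                ⊕ (q ℕ.^ ((d ℕ.∸ 2) ℕ./ 2) ℕ.* n) ÷ 2
      even-minus k d≡ E≡ = clear-even n q m k (half (suc k) d≡) (half k (cong (ℕ._∸ 2) d≡))
        (≤-from-difference {1ℤ} _ (even-bound A A! (suc k) d≡ minus E≡) (lem (ℤ.+ n) Q (Q ℤ.^ k) (ℤ.+ m)))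
        where
        -- R is the power with exponent (d - 2)/2; `Q ℤ.^ suc k` unfolds to `Q * Q ℤ.^ k`.
        lem : ∀ N Q R M → let P = Q * R in
          N * (N * (-1ℤ * P * (Q * 1ℤ) + (P * P * 1ℤ - -1ℤ * P * 1ℤ) * (Q * 1ℤ - -1ℤ * 1ℤ)))
            + - (-1ℤ * P * Q * -1ℤ) * (ℤ.+ 2 * M - N * N)
            - (Q * (N * N) * (1ℤ - -1ℤ * 1ℤ) + P * P * 1ℤ * (N * N - N) * (Q * 1ℤ - -1ℤ * 1ℤ))
          ≡ 1ℤ * (N * N * (P * Q) + 1ℤ * (N * N) * P - N * N * (ℤ.+ 2 * Q) + P * N * (P * Q) + R * N * (P * Q)
            - M * (ℤ.+ 2 * (P * Q)))
        lem = solve-∀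

      -- Again the weight vanishes at 0, and the common factor P cancels.
      even-plus : ∀ k → d ≡ suc k ℕ.* 2 ℕ.+ 0 → (ε * Q) ℤ.^ suc k ≡ 1ℤ * Q ℤ.^ suc k →
        count ℚ.≤ n ℕ.^ 2 ÷ 2 ⊕ ½ ⊛ (n ℕ.^ 2 ÷ q)
                ⊕ (q ℕ.^ (d ℕ./ 2) ℕ.* n) ÷ 2
                ⊖ (q ℕ.^ ((d ℕ.∸ 2) ℕ./ 2) ℕ.* n) ÷ 2
      even-plus k d≡ E≡ = clear-difference n q m k (half (suc k) d≡) (half k (cong (ℕ._∸ 2) d≡))
        (≤-from-difference (^-positive (suc k) 0<Q) (even-bound A A! (suc k) d≡ plus E≡)
          (lem (ℤ.+ n) Q (Q ℤ.^ k) (ℤ.+ m)))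
        where
        lem : ∀ N Q R M → let P = Q * R in
          N * (N * (1ℤ * P * (Q * 1ℤ) + (P * P * 1ℤ - 1ℤ * P * 1ℤ) * (Q * 1ℤ - 1ℤ * 1ℤ)))
            + - (1ℤ * P * Q * 1ℤ) * (ℤ.+ 2 * M - N * N)
            - (Q * (N * N) * (1ℤ - 1ℤ * 1ℤ) + P * P * 1ℤ * (N * N - N) * (Q * 1ℤ - 1ℤ * 1ℤ))
          ≡ P * (N * N * Q + 1ℤ * (N * N) + P * N * Q - R * N * Q - M * (ℤ.+ 2 * Q))
        lem = solve-∀

open import Data.Nat using (suc; NonZero; _+_; _*_; _∸_; _^_; _/_; _%_; _≥_)
open import Data.Rational using (½; _≤_) renaming (_+_ to _⊕_; _-_ to _⊖_; _*_ to _⊛_)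
open import Data.List using (List; length)
open import Data.Product using (_×_; _,_)
open import Data.Sum using (_⊎_; inj₁; inj₂)
open import Relation.Binary.PropositionalEquality using (_≡_)
open Sums using (0-mod-4; 1-mod-4; 2-mod-4; 3-mod-4; 1-mod-2)

theorem1p2 :
  ∀ {c ℓ : Level} (q : ℕ) .{{_ : NonZero q}} → OddPrimePower q →
  (F : FiniteField c ℓ q) →
  (d : ℕ) → d ≥ 1 →
  (A : List (Point F d)) → Distinct F A →
  let n = length A
      count = (SQ F A + ZR F A) ÷ 1
  in
    (d % 4 ≡ 3 × q % 4 ≡ 3 →
      count ≤ n ^ 2 ÷ 2 ⊕ ½ ⊛ (n ^ 2 ÷ q)
              ⊖ ½ ⊛ (n ^ 2 ÷⟨ q ^ ((d ∸ 1) / 2) ⟩)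
              ⊖ ½ ⊛ (n ^ 2 ÷⟨ q ^ ((d + 1) / 2) ⟩)
              ⊕ (q ^ ((d ∸ 1) / 2) * n) ÷ 1)
  × (d % 4 ≡ 1 ⊎ (d % 4 ≡ 3 × q % 4 ≡ 1) →
      count ≤ n ^ 2 ÷ 2 ⊕ ½ ⊛ (n ^ 2 ÷ q)
              ⊕ (q ^ ((d + 1) / 2) * n) ÷ 2
              ⊖ (q ^ ((d ∸ 1) / 2) * n) ÷ 2)
  × (d % 4 ≡ 2 × q % 4 ≡ 3 →
      count ≤ n ^ 2 ÷ 2 ⊕ ½ ⊛ (n ^ 2 ÷ q)
              ⊖ n ^ 2 ÷⟨ q ^ (d / 2) ⟩
              ⊕ (q ^ (d / 2) * n) ÷ 2
              ⊕ (q ^ ((d ∸ 2) / 2) * n) ÷ 2)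
  × (d % 4 ≡ 0 ⊎ (d % 4 ≡ 2 × q % 4 ≡ 1) →
      count ≤ n ^ 2 ÷ 2 ⊕ ½ ⊛ (n ^ 2 ÷ q)
              ⊕ (q ^ (d / 2) * n) ÷ 2
              ⊖ (q ^ ((d ∸ 2) / 2) * n) ÷ 2)
theorem1p2 q (q-odd , _) F d d≥1 A A! =
    -- Each case fixes the sign ε^⌊d/2⌋: it is 1 for even ⌊d/2⌋ whatever q is, and ε for odd ⌊d/2⌋,
    -- where q mod 4 decides.
    (λ (d%4≡3 , q%4≡3) → odd-minus A A! (suc (j * 2)) (3-mod-4 d%4≡3) (εQ^-odd-sign j (ε≡-1 q%4≡3)))
  , (λ { (inj₁ d%4≡1)           → odd-plus A A! (j * 2) (1-mod-4 d%4≡1) (εQ^-even j)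
       ; (inj₂ (d%4≡3 , q%4≡1)) → odd-plus A A! (suc (j * 2)) (3-mod-4 d%4≡3) (εQ^-odd-sign j (ε≡1 q%4≡1)) })
  , (λ (d%4≡2 , q%4≡3) → even-minus A A! (j * 2) (2-mod-4 d%4≡2) (εQ^-odd-sign j (ε≡-1 q%4≡3)))
  -- `even-plus` expects the predecessor of d/2, which is 2 i + 1 for d = 4 (i + 1).
  , (λ { (inj₁ d%4≡0)           → let i , d≡ = 0-mod-4 d≥1 d%4≡0 in even-plus A A! (suc (i * 2)) d≡ (εQ^-even (suc i))
       ; (inj₂ (d%4≡2 , q%4≡1)) → even-plus A A! (j * 2) (2-mod-4 d%4≡2) (εQ^-odd-sign j (ε≡1 q%4≡1)) })
  where
  j = d / 4
  open FieldSums F using (char≢2; module OddCharacteristic)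
  open OddCharacteristic (char≢2 {q / 2} (1-mod-2 q-odd))
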